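{- For any integer $k\geq 3$, $$gr_k^{*}(K_{3}: K_{1, m})= \begin{cases} 2m-2, & \text{if } m\geq 12 \text{ is even},\\ m, & \text{if } m\geq 3 \text{ is odd}.\end{cases}$$
   Context: $K_{1,m}$ is the star with $m$ edges. A $k$-edge-coloring uses colors from $[k]=\{1,\ldots,k\}$. A subgraph is monochromatic if all its edges have the same color and rainbow if no two of its edges have the same color. The Gallai-Ramsey number $gr_k(K_3: H)$ is the smallest integer $n$ such that every $k$-edge-colored $K_n$ contains either a rainbow $K_3$ or a monochromatic copy of $H$. For $n=gr_k(K_3:H)$ and $0\le s\le n-1$, $K_{n-1}\sqcup K_{1,s}$ denotes the graph obtained from $K_{n-1}$ by adding a new vertex $v$ and $s$ edges joining $v$ to $s$ vertices of $K_{n-1}$. The star-critical Gallai-Ramsey number $gr_k^{*}(K_3: H)$ is the smallest integer $s$ such that every $k$-edge-colored $K_{n-1}\sqcup K_{1,s}$ contains either a rainbow $K_3$ or a monochromatic copy of $H$. -}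

module Defs where

open import Data.Nat using (ℕ; zero; suc; _+_; _*_; _∸_; _≤_; _<_)
open import Data.Fin using (Fin; toℕ; fromℕ)
open import Data.Product using (Σ; _×_; _,_; ∃-syntax)
open import Data.Sum using (_⊎_)
open import Relation.Binary.PropositionalEquality using (_≡_; _≢_)
open import Relation.Nullary using (¬_)
open import Function.Definitions using (Injective)

-- A host graph on vertex set Fin N, given by its (symmetric, irreflexive) edge relation.
Graph : ℕ → Set₁
Graph N = Fin N → Fin N → Set

-- A k-edge-colouring of a graph: colours from Fin k (i.e. [k]), on unordered pairs,
-- represented as a symmetric function on ordered pairs (only values on edges matter).
Colouring : ℕ → ℕ → Set
Colouring k N = Fin N → Fin N → Fin k

Symmetric : ∀ {k N} → Colouring k N → Set
Symmetric {N = N} c = ∀ (i j : Fin N) → c i j ≡ c j i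

Complete : (N : ℕ) → Graph N
Complete N i j = i ≢ j

-- K_{n-1} ⊔ K_{1,s} with n = suc n': vertices Fin (suc n'), where vertices 0..n'-1
-- form K_{n-1} and the last vertex v = fromℕ n' is joined to the s vertices 0..s-1.
KplusStar : (n' s : ℕ) → Graph (suc n')
KplusStar n' s i j =
  i ≢ j ×
  ((toℕ i < n' × toℕ j < n')
   ⊎ (i ≡ fromℕ n' × toℕ j < s)
   ⊎ (j ≡ fromℕ n' × toℕ i < s))

RainbowK3 : ∀ {k N} → Graph N → Colouring k N → Set
RainbowK3 {N = N} G c =
  Σ (Fin N) λ x → Σ (Fin N) λ y → Σ (Fin N) λ z →
    G x y × G y z × G x z ×
    c x y ≢ c y z × c y z ≢ c x z × c x y ≢ c x z

MonoStar : ∀ {k N} → Graph N → Colouring k N → ℕ → Set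
MonoStar {k} {N} G c m =
  Σ (Fin N) λ x → Σ (Fin k) λ col → Σ (Fin m → Fin N) λ f →
    Injective _≡_ _≡_ f × (∀ i → G x (f i) × c x (f i) ≡ col)

Arrows : ∀ {N} → ℕ → ℕ → Graph N → Set
Arrows {N} k m G =
  (c : Colouring k N) → Symmetric c → RainbowK3 G c ⊎ MonoStar G c m

IsGR : ℕ → ℕ → ℕ → Set
IsGR k m n = Arrows k m (Complete n) × (∀ n₁ → Arrows k m (Complete n₁) → n ≤ n₁)

IsGRStar : ℕ → ℕ → ℕ → ℕ → Set
IsGRStar k m n s =
  Σ ℕ λ n' → n ≡ suc n' ×
    (s ≤ n' × Arrows k m (KplusStar n' s)
     × (∀ s₁ → s₁ ≤ n' → Arrows k m (KplusStar n' s₁) → s ≤ s₁))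

{-# OPTIONS --safe #-}
-- A colouring without rainbow triangle of a complete graph has two colours r, b such that the edges of the
-- other colours do not connect it (Gallai); between two of the resulting classes all edges have one colour,
-- r or b. Let d = m − 1 bound the monochromatic degrees. Each class has at least n − 2d vertices, and on
-- K_{gr−1} this exceeds d/3, so no class sees three classes in one colour; this forces exactly five classes,
-- arranged as a red and a blue pentagon. Any two of the five have a common neighbour class in one colour,
-- so two class sizes add up to at most d: for m = 2e + 1 all sizes are e, for m = 2e + 2 they are e + 1, e, e, e, e.
-- The extra vertex v may then not use the colours exhausted at its neighbours, and counting its edges bounds
-- its degree. Conversely blow-ups of the pentagon colouring, with v added, avoid both structures.
module Submission where

open import Defs
open import Data.Bool using (Bool; true; false; if_then_else_; not)
open import Data.Bool.Properties using () renaming (_≟_ to _≟ᵇ_)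
open import Data.Empty using (⊥; ⊥-elim)
open import Data.Fin using (Fin; zero; suc; toℕ; fromℕ; fromℕ<; inject₁; inject≤; _≟_)
open import Data.Fin.Patterns using (0F; 1F; 2F; 3F; 4F; 5F)
open import Data.Fin.Properties using (suc-injective; toℕ-injective; toℕ<n; toℕ-inject₁; toℕ-inject≤;
  inject₁-injective; inject≤-injective; fromℕ<-injective; fromℕ≢inject₁; injective⇒≤; any?; all?)
open import Data.Nat using (ℕ; zero; suc; _+_; _*_; _∸_; _≤_; _<_; z≤n; s≤s; s≤s⁻¹; _<?_; _%_; _/_)
open import Data.Nat.DivMod using (m≡m%n+[m/n]*n)
open import Data.Nat.Properties hiding (suc-injective; _≟_)
open import Data.Nat.Tactic.RingSolver using (solve-∀)
open import Data.Product using (Σ; ∃; _×_; _,_; proj₁; proj₂)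
open import Data.Sum using (_⊎_; inj₁; inj₂; [_,_]′; swap)
open import Data.Vec using (Vec; []; _∷_; lookup; sum)
open import Function using (_∘_; id)
open import Function.Definitions using (Injective)
open import Relation.Binary.Construct.Closure.ReflexiveTransitive using (Star; ε; _◅_; _◅◅_; reverse)
open import Relation.Binary.PropositionalEquality using (_≡_; _≢_; refl; sym; trans; cong; subst; subst₂)
open import Relation.Nullary using (¬_; Dec; yes; no; contradiction; ¬?; _×-dec_; _⊎-dec_; _→-dec_)
open import Relation.Nullary.Decidable using (¬¬-excluded-middle; from-yes)
open import Relation.Unary using (Decidable)

private
  variable
    k n : ℕ

-- Counting the elements of `Fin n` that satisfy a decidable predicate.

bit : {A : Set} → Dec A → ℕ
bit (yes _) = 1
bit (no _) = 0

bit-yes : {A : Set} (a? : Dec A) → A → 1 ≤ bit a?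
bit-yes (yes _) _ = ≤-refl
bit-yes (no ¬a) a = contradiction a ¬a

bit-⊎ : {A B C : Set} (a? : Dec A) (b? : Dec B) (c? : Dec C) →
  (A → B ⊎ C) → bit a? ≤ bit b? + bit c?
bit-⊎ (no _) b? c? f = z≤n
bit-⊎ (yes a) b? c? f with f a
... | inj₁ b = ≤-trans (bit-yes b? b) (m≤m+n _ _)
... | inj₂ c = ≤-trans (bit-yes c? c) (m≤n+m _ (bit b?))

bit-disjoint : {A B C : Set} (a? : Dec A) (b? : Dec B) (c? : Dec C) →
  (B → A) → (C → A) → (B → ¬ C) → bit b? + bit c? ≤ bit a?
bit-disjoint a? (yes b) (yes c) f g d = contradiction c (d b)
bit-disjoint a? (yes b) (no _) f g d = bit-yes a? (f b)
bit-disjoint a? (no _) (yes c) f g d = bit-yes a? (g c)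
bit-disjoint a? (no _) (no _) f g d = z≤n

# : {P : Fin n → Set} → Decidable P → ℕ
# {zero} P? = 0
# {suc n} P? = bit (P? zero) + # (P? ∘ suc)

interchange : ∀ a b c d → (a + b) + (c + d) ≡ (a + c) + (b + d)
interchange = solve-∀

#-⊎ : {P Q R : Fin n → Set} (P? : Decidable P) (Q? : Decidable Q) (R? : Decidable R) →
  (∀ i → P i → Q i ⊎ R i) → # P? ≤ # Q? + # R?
#-⊎ {n = zero} P? Q? R? f = z≤n
#-⊎ {n = suc n} P? Q? R? f = ≤-trans
  (+-mono-≤ (bit-⊎ (P? zero) (Q? zero) (R? zero) (f zero)) (#-⊎ (P? ∘ suc) (Q? ∘ suc) (R? ∘ suc) (f ∘ suc)))
  (≤-reflexive (interchange (bit (Q? zero)) (bit (R? zero)) (# (Q? ∘ suc)) (# (R? ∘ suc))))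

#-disjoint : {P Q R : Fin n → Set} (P? : Decidable P) (Q? : Decidable Q) (R? : Decidable R) →
  (∀ i → Q i → P i) → (∀ i → R i → P i) → (∀ i → Q i → ¬ R i) → # Q? + # R? ≤ # P?
#-disjoint {n = zero} P? Q? R? f g d = z≤n
#-disjoint {n = suc n} P? Q? R? f g d = ≤-trans
  (≤-reflexive (interchange (bit (Q? zero)) (# (Q? ∘ suc)) (bit (R? zero)) (# (R? ∘ suc))))
  (+-mono-≤ (bit-disjoint (P? zero) (Q? zero) (R? zero) (f zero) (g zero) (d zero))
            (#-disjoint (P? ∘ suc) (Q? ∘ suc) (R? ∘ suc) (f ∘ suc) (g ∘ suc) (d ∘ suc)))

#-mono : {P Q : Fin n → Set} (P? : Decidable P) (Q? : Decidable Q) →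
  (∀ i → P i → Q i) → # P? ≤ # Q?
#-mono {n} P? Q? f = ≤-trans (#-⊎ P? Q? (λ _ → no id) (λ i → inj₁ ∘ f i))
  (≤-reflexive (trans (cong (# Q? +_) (#-∅ n)) (+-identityʳ _)))
  where
  #-∅ : ∀ n → # {n} {λ _ → ⊥} (λ _ → no id) ≡ 0
  #-∅ zero = refl
  #-∅ (suc n) = #-∅ n

#-universal : {P : Fin n → Set} (P? : Decidable P) → (∀ i → P i) → n ≤ # P?
#-universal {zero} P? p = z≤n
#-universal {suc n} P? p = +-mono-≤ (bit-yes (P? zero) (p zero)) (#-universal (P? ∘ suc) (p ∘ suc))

#-⊎₃ : {P Q R S : Fin n → Set} (P? : Decidable P) (Q? : Decidable Q) (R? : Decidable R) (S? : Decidable S) →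
  (∀ i → P i → Q i ⊎ R i ⊎ S i) → # P? ≤ # Q? + (# R? + # S?)
#-⊎₃ P? Q? R? S? f = ≤-trans (#-⊎ P? Q? (λ i → R? i ⊎-dec S? i) f)
  (+-monoʳ-≤ (# Q?) (#-⊎ _ R? S? (λ _ → id)))

#-inhabited : {P : Fin n → Set} (P? : Decidable P) → ∀ i → P i → 1 ≤ # P?
#-inhabited P? zero p = ≤-trans (bit-yes (P? zero) p) (m≤m+n _ _)
#-inhabited P? (suc i) p = ≤-trans (#-inhabited (P? ∘ suc) i p) (m≤n+m _ (bit (P? zero)))

#-∃ : {P : Fin n → Set} (P? : Decidable P) → 0 < # P? → ∃ P
#-∃ {zero} P? ()
#-∃ {suc n} P? lt with P? zero
... | yes p = zero , p
... | no _ = let i , p = #-∃ (P? ∘ suc) lt in suc i , p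

#-enumerate : {P : Fin n → Set} (P? : Decidable P) →
  Σ (Fin (# P?) → Fin n) λ f → Injective _≡_ _≡_ f × (∀ i → P (f i))
#-enumerate {zero} P? = (λ ()) , (λ {}) , λ ()
#-enumerate {suc n} {P} P? with P? zero | #-enumerate (P? ∘ suc)
... | no _ | f , inj , p = suc ∘ f , inj ∘ suc-injective , p
... | yes p₀ | f , inj , p = g , g-inj , g-P
  where
  g : Fin (suc (# (P? ∘ suc))) → Fin (suc n)
  g zero = zero
  g (suc i) = suc (f i)
  g-inj : Injective _≡_ _≡_ g
  g-inj {zero} {zero} _ = refl
  g-inj {suc i} {suc j} eq = cong suc (inj (suc-injective eq))
  g-P : ∀ i → P (g i)
  g-P zero = p₀
  g-P (suc i) = p i

#-last : {P : Fin (suc n) → Set} (P? : Decidable P) →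
  # P? ≡ # (P? ∘ inject₁) + bit (P? (fromℕ n))
#-last {zero} P? = +-identityʳ _
#-last {suc n} P? = trans (cong (bit (P? zero) +_) (#-last (P? ∘ suc)))
  (sym (+-assoc (bit (P? zero)) _ _))

#-initial : ∀ {n} s → s ≤ n → s ≤ # {n} (λ i → toℕ i <? s)
#-initial zero _ = z≤n
#-initial {suc n} (suc s) (s≤s s≤n) = s≤s (≤-trans (#-initial s s≤n)
  (#-mono {n} (λ i → toℕ i <? s) (λ i → toℕ (suc i) <? suc s) (λ _ → s≤s)))

-- Colourings without rainbow triangle, and connection outside two colours.

Gallai : Colouring k n → Set
Gallai c = ∀ x y z → c x y ≢ c x z → c y z ≡ c x y ⊎ c y z ≡ c x z

Outside : Fin k → Fin k → Fin k → Set
Outside r b col = col ≢ r × col ≢ b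

outside? : (r b col : Fin k) → (col ≡ r ⊎ col ≡ b) ⊎ Outside r b col
outside? r b col with col ≟ r | col ≟ b
... | yes p | _ = inj₁ (inj₁ p)
... | no _ | yes q = inj₁ (inj₂ q)
... | no p | no q = inj₂ (p , q)

other : ∀ {r b col : Fin k} → col ≡ r ⊎ col ≡ b → col ≢ r → col ≡ b
other (inj₁ p) q = contradiction p q
other (inj₂ p) q = p

inside-≢ : ∀ {r b col col′ : Fin k} → Outside r b col → col′ ≡ r ⊎ col′ ≡ b → col ≢ col′
inside-≢ (p , _) (inj₁ q) e = p (trans e q)
inside-≢ (_ , p) (inj₂ q) e = p (trans e q)

-- The walks use only edges coloured neither `r` nor `b`, where `r` and `b` may coincide. Its
-- classes are the components of what remains when these two colours are deleted.
Conn : Colouring k n → Fin k → Fin k → Fin n → Fin n → Set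
Conn c r b = Star (λ x y → Outside r b (c x y))

module _ (c : Colouring k n) (sym-c : Symmetric c) (gallai : Gallai c) (r b : Fin k) where

  conn-sym : ∀ {x y} → Conn c r b x y → Conn c r b y x
  conn-sym = reverse λ {x} {y} → subst (Outside r b) (sym-c x y)

  conn-cross : ∀ {x y} → ¬ Conn c r b x y → c x y ≡ r ⊎ c x y ≡ b
  conn-cross {x} {y} ¬xy with outside? r b (c x y)
  ... | inj₁ p = p
  ... | inj₂ q = contradiction (q ◅ ε) ¬xy

  -- Along one step of the walk both edges to `z` have colour `r` or `b`, while the step itself has
  -- neither. If the two edges differed, the triangle would be rainbow.
  conn-homogeneous : ∀ {x y z} → Conn c r b x y → ¬ Conn c r b z x → c z x ≡ c z y
  conn-homogeneous ε _ = refl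
  conn-homogeneous {x} {y} {z} (_◅_ {j = x′} e p) ¬zx = trans same (conn-homogeneous p ¬zx′)
    where
    ¬zx′ : ¬ Conn c r b z x′
    ¬zx′ q = ¬zx (q ◅◅ conn-sym (e ◅ ε))
    same : c z x ≡ c z x′
    same with c z x ≟ c z x′
    ... | yes p = p
    ... | no q with gallai z x x′ q
    ...   | inj₁ t = contradiction t (inside-≢ e (conn-cross ¬zx))
    ...   | inj₂ t = contradiction t (inside-≢ e (conn-cross ¬zx′))

-- Gallai's structure theorem, by removing one vertex.

module Extend (c : Colouring k (suc n)) (sym-c : Symmetric c) (gallai : Gallai c)
  (H : ∀ r b x y → ¬ ¬ Conn c r b x y) (r b : Fin k) (x y : Fin n) where

  c′ : Colouring k n
  c′ i j = c (suc i) (suc j)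

  gallai′ : Gallai c′
  gallai′ i j l = gallai (suc i) (suc j) (suc l)

  sym-c′ : Symmetric c′
  sym-c′ i j = sym-c (suc i) (suc j)

  w : Fin n → Fin k
  w i = c zero (suc i)

  _~_ : Fin n → Fin n → Set
  _~_ = Conn c′ r b

  ~-sym : ∀ {i j} → i ~ j → j ~ i
  ~-sym = conn-sym c′ sym-c′ gallai′ r b

  cross : ∀ {i j} → ¬ i ~ j → c′ i j ≡ r ⊎ c′ i j ≡ b
  cross = conn-cross c′ sym-c′ gallai′ r b

  homogeneous : ∀ {i j l} → i ~ j → ¬ l ~ i → c′ l i ≡ c′ l j
  homogeneous = conn-homogeneous c′ sym-c′ gallai′ r b

  Hit : Fin n → Set
  Hit i = ∃ λ j → i ~ j × Outside r b (w j)

  -- The walk is cut at its first arrival at `zero`, so that the piece before it stays among the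
  -- remaining vertices.
  lastStep : ∀ {i} → Conn c r b (suc i) zero → Hit i
  lastStep {i} (_◅_ {j = zero} e _) = i , ε , subst (Outside r b) (sym-c (suc i) zero) e
  lastStep (_◅_ {j = suc j} e p) = let l , q , o = lastStep p in l , e ◅ q , o

  hit : ∀ i → ¬ ¬ Hit i
  hit i ¬h = H r b (suc i) zero (¬h ∘ lastStep)

  firstStep : ∀ {r b i} → Conn c r b zero (suc i) → ∃ λ j → Outside r b (w j)
  firstStep (_◅_ {j = zero} _ p) = firstStep p
  firstStep (_◅_ {j = suc j} e _) = j , e

  hits-agree : ∀ {i j} → ¬ i ~ j → Outside r b (w i) → Outside r b (w j) → w i ≡ w j
  hits-agree {i} {j} ¬ij o o′ with w i ≟ w j
  ... | yes p = p
  ... | no q with gallai zero (suc i) (suc j) q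
  ...   | inj₁ t = contradiction (sym t) (inside-≢ o (cross ¬ij))
  ...   | inj₂ t = contradiction (sym t) (inside-≢ o′ (cross ¬ij))

  forced : ∀ {i j} → ¬ i ~ j → Outside r b (w i) → w j ≢ w i → c′ i j ≡ w j
  forced {i} {j} ¬ij o ne with gallai zero (suc i) (suc j) (ne ∘ sym)
  ... | inj₁ t = contradiction (sym t) (inside-≢ o (cross ¬ij))
  ... | inj₂ t = t

  -- Every edge at the new vertex has the common colour g of its edges outside {r, b}, or colour r,
  -- or colour b; edges i of colour b and j of colour r would contradict homogeneity.
  absurd : ¬ x ~ y → ⊥
  absurd ¬xy =
    hit x λ { (x′ , xx′ , ox) →
    hit y λ { (y′ , yy′ , oy) →
    -- With g = `w x′`, connectedness outside {r, g} yields an edge at `zero` avoiding `r` and g,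
    -- and connectedness outside {g, b} one avoiding g and `b`.
    H r (w x′) zero (suc x) λ p →
    H (w x′) b zero (suc x) λ q →
    ¬¬-excluded-middle λ i~j? →
    clash x′ xx′ ox y′ yy′ oy (firstStep p) (firstStep q) i~j? }}
    where
    clash : ∀ x′ → x ~ x′ → Outside r b (w x′) → ∀ y′ → y ~ y′ → Outside r b (w y′) →
      (I : ∃ λ i → Outside r (w x′) (w i)) (J : ∃ λ j → Outside (w x′) b (w j)) →
      Dec (proj₁ I ~ proj₁ J) → ⊥
    clash x′ xx′ ox y′ yy′ oy (i , i≢r , i≢g) (j , j≢g , j≢b) = cases
      where
      ¬xy′ : ¬ x′ ~ y′
      ¬xy′ p = ¬xy (xx′ ◅◅ (p ◅◅ ~-sym yy′))
      g≡ : w x′ ≡ w y′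
      g≡ = hits-agree ¬xy′ ox oy
      value : ∀ {l} → w l ≢ w x′ → ¬ ¬ (w l ≡ r ⊎ w l ≡ b)
      -- The vertex `l` cannot be in the classes of both `x′` and `y′`. From the one whose class it
      -- avoids, the edge to `l` is forced to have colour `w l`, and between classes only `r` and
      -- `b` occur.
      value {l} l≢g ¬v = ¬v′ λ x′l → ¬v″ λ y′l → ¬xy′ (x′l ◅◅ ~-sym y′l)
        where
        ¬v′ : ¬ ¬ (x′ ~ l)
        ¬v′ ¬x′l = ¬v (subst (λ z → z ≡ r ⊎ z ≡ b) (forced ¬x′l ox l≢g) (cross ¬x′l))
        ¬v″ : ¬ ¬ (y′ ~ l)
        ¬v″ ¬y′l = ¬v (subst (λ z → z ≡ r ⊎ z ≡ b) (forced ¬y′l oy (λ e → l≢g (trans e (sym g≡)))) (cross ¬y′l))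
      sameClass : i ~ j → ∀ l → ¬ l ~ i → Outside r b (w l) → w l ≡ w x′ → w i ≢ w j → ⊥
      sameClass ij l ¬li o e ne = ne (trans (sym (forced ¬li o (λ t → i≢g (trans t e))))
        (trans (homogeneous ij ¬li) (forced (λ t → ¬li (t ◅◅ ~-sym ij)) o (λ t → j≢g (trans t e)))))
      cases : Dec (i ~ j) → ⊥
      cases d = value i≢g λ vi → value j≢g λ vj → clash′ d (other vi i≢r) (other (swap vj) j≢b)
        where
        clash′ : Dec (i ~ j) → w i ≡ b → w j ≡ r → ⊥
        clash′ (yes ij) wi wj =
          ¬¬-excluded-middle λ where
            (no ¬x′i) → sameClass ij x′ ¬x′i ox refl i≢j
            (yes x′i) → sameClass ij y′ (λ t → ¬xy′ (x′i ◅◅ ~-sym t)) oy (sym g≡) i≢j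
          where
          i≢j : w i ≢ w j
          i≢j e = i≢r (trans e wj)
        -- Let `i′` and `j′` be hits in the classes of `i` and `j`. The edge from `i′` to `j` is
        -- forced to have colour `w j`, the one from `j′` to `i` colour `w i`; by homogeneity both
        -- equal the colour of the edge between `i` and `j`.
        clash′ (no ¬ij) wi wj =
          hit i λ { (i′ , ii′ , oi) → hit j λ { (j′ , jj′ , oj) →
          let ¬i′j : ¬ i′ ~ j
              ¬i′j t = ¬ij (ii′ ◅◅ t)
              ¬j′i : ¬ j′ ~ i
              ¬j′i t = ¬ij (~-sym (jj′ ◅◅ t))
              ne₁ : w j ≢ w i′
              ne₁ = λ t → inside-≢ oi (inj₁ wj) (sym t)
              ne₂ : w i ≢ w j′
              ne₂ = λ t → inside-≢ oj (inj₂ wi) (sym t)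
              e₁ : c′ i j ≡ w j
              e₁ = trans (sym-c′ i j) (trans (homogeneous ii′ (¬ij ∘ ~-sym)) (trans (sym-c′ j i′) (forced ¬i′j oi ne₁)))
              e₂ : c′ i j ≡ w i
              e₂ = trans (homogeneous jj′ ¬ij) (trans (sym-c′ i j′) (forced ¬j′i oj ne₂))
          in i≢r (trans (sym e₂) (trans e₁ wj)) }}

-- Gallai's structure theorem: the components outside two suitable colours form a nontrivial partition.
disconnected : ∀ n (c : Colouring k (suc (suc n))) → Symmetric c → Gallai c →
  ¬ (∀ r b x y → ¬ ¬ Conn c r b x y)
-- On two vertices both deleted colours are taken to be the colour of the only edge.
disconnected zero c sym-c gallai H = H (c x y) (c x y) x y cross
  where
  x y : Fin 2
  x = zero
  y = suc zero
  cross : ¬ Conn c (c x y) (c x y) x y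
  cross (_◅_ {j = zero} _ p) = cross p
  cross (_◅_ {j = suc zero} (ne , _) _) = ne refl
disconnected (suc n) c sym-c gallai H =
  disconnected n _ (λ i j → sym-c (suc i) (suc j)) (λ i j l → gallai (suc i) (suc j) (suc l))
    λ r b x y → Extend.absurd c sym-c gallai H r b x y

-- Monochromatic degrees and blow-ups of the pentagon colouring.

deg : Colouring k n → Fin n → Fin k → ℕ
deg c x col = # (λ y → ¬? (x ≟ y) ×-dec (c x y ≟ col))

-- Adjacency in the 5-cycle 0, 1, 2, 3, 4. Its complement is a 5-cycle as well, which gives the
-- two-colouring of the complete graph on five vertices without monochromatic triangle.
cyclic : Fin 5 → Fin 5 → Bool
cyclic i j = lookup (lookup table i) j
  where
  table : Vec (Vec Bool 5) 5
  table = (false ∷ true  ∷ false ∷ false ∷ true  ∷ [])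
        ∷ (true  ∷ false ∷ true  ∷ false ∷ false ∷ [])
        ∷ (false ∷ true  ∷ false ∷ true  ∷ false ∷ [])
        ∷ (false ∷ false ∷ true  ∷ false ∷ true  ∷ [])
        ∷ (true  ∷ false ∷ false ∷ true  ∷ false ∷ [])
        ∷ []

pent : {A : Set} → A → A → Fin 5 → Fin 5 → A
pent r b i j = if cyclic i j then r else b

-- Only the colours between different parts are prescribed. The representatives ensure that none of
-- the five parts is empty.
record Pentagon (c : Colouring k n) : Set where
  field
    r b : Fin k
    r≢b : r ≢ b
    part : Fin n → Fin 5
    rep : Fin 5 → Fin n
    part-rep : ∀ i → part (rep i) ≡ i
    colour : ∀ x y → part x ≢ part y → c x y ≡ pent r b (part x) (part y)

-- From bounded degrees to exactly five classes.

module Classes (c : Colouring k n) (sym-c : Symmetric c) (d t : ℕ)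
  (size : d + d + t ≤ n) (d<3t : d < t + (t + t)) (deg≤d : ∀ x col → deg c x col ≤ d)
  (_~_ : Fin n → Fin n → Set) (_~?_ : ∀ x y → Dec (x ~ y))
  (~-refl : ∀ {x} → x ~ x) (~-sym : ∀ {x y} → x ~ y → y ~ x) (~-trans : ∀ {x y z} → x ~ y → y ~ z → x ~ z)
  (homogeneous : ∀ {x y z} → x ~ y → ¬ z ~ x → c z x ≡ c z y)
  {x₀ y₀ : Fin n} (x₀≁y₀ : ¬ x₀ ~ y₀) where

  cls : Fin n → ℕ
  cls x = # (x ~?_)

  ≁⇒≢ : ∀ {x y} → ¬ x ~ y → x ≢ y
  ≁⇒≢ ¬xy refl = ¬xy ~-refl

  0<t : 0 < t
  0<t = positive t d<3t
    where
    positive : ∀ t → d < t + (t + t) → 0 < t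
    positive (suc t) _ = s≤s z≤n

  -- By homogeneity all edges from z to the class of y then have colour col.
  Joined : Fin k → Fin n → Fin n → Set
  Joined col z y = ¬ z ~ y × c z y ≡ col

  joined-sym : ∀ {col x y} → Joined col x y → Joined col y x
  joined-sym {_} {x} {y} (¬xy , e) = ¬xy ∘ ~-sym , trans (sym-c y x) e

  joined-cls : ∀ {col z y u} → Joined col z y → y ~ u → z ≢ u × c z u ≡ col
  joined-cls (¬zy , e) yu = ≁⇒≢ (λ zu → ¬zy (~-trans zu (~-sym yu))) , trans (sym (homogeneous yu ¬zy)) e

  -- By homogeneity the whole class of `y` lies in the `col`-neighbourhood of `z`. The two variants
  -- below add up pairwise disjoint classes inside the same neighbourhood.
  joined₁ : ∀ {col z y} → Joined col z y → cls y ≤ d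
  joined₁ {col} {z} {y} j = ≤-trans
    (#-mono {n} (y ~?_) (λ u → ¬? (z ≟ u) ×-dec (c z u ≟ col)) (λ _ → joined-cls j))
    (deg≤d z col)

  joined₂ : ∀ {col z y y′} → Joined col z y → Joined col z y′ → ¬ y ~ y′ → cls y + cls y′ ≤ d
  joined₂ {col} {z} {y} {y′} j j′ ¬yy′ = ≤-trans
    (#-disjoint {n} (λ u → ¬? (z ≟ u) ×-dec (c z u ≟ col)) (y ~?_) (y′ ~?_)
      (λ _ → joined-cls j) (λ _ → joined-cls j′) (λ _ p q → ¬yy′ (~-trans p (~-sym q))))
    (deg≤d z col)

  joined₃ : ∀ {col z y y′ y″} → Joined col z y → Joined col z y′ → Joined col z y″ →
    ¬ y ~ y′ → ¬ y ~ y″ → ¬ y′ ~ y″ → cls y + (cls y′ + cls y″) ≤ d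
  joined₃ {col} {z} {y} {y′} {y″} j j′ j″ n₁ n₂ n₃ = ≤-trans
    (+-monoʳ-≤ (cls y) (#-disjoint {n} two? (y′ ~?_) (y″ ~?_) (λ _ → inj₁) (λ _ → inj₂)
      (λ _ p q → n₃ (~-trans p (~-sym q)))))
    (≤-trans
      (#-disjoint {n} (λ u → ¬? (z ≟ u) ×-dec (c z u ≟ col)) (y ~?_) two?
        (λ _ → joined-cls j) (λ _ → [ joined-cls j′ , joined-cls j″ ]′)
        (λ _ p → [ (λ q → n₁ (~-trans p (~-sym q))) , (λ q → n₂ (~-trans p (~-sym q))) ]′))
      (deg≤d z col))
    where
    two? : ∀ u → Dec (y′ ~ u ⊎ y″ ~ u)
    two? u = (y′ ~? u) ⊎-dec (y″ ~? u)

  -- Otherwise the class of `z` and its `col`-neighbourhood cover everything. The class has at most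
  -- `d` vertices, being seen in one colour from any vertex outside it, so n would be at most 2d.
  not-complete : ∀ z col → ¬ (∀ y → ¬ z ~ y → c z y ≡ col)
  not-complete z col all = <⇒≱ (m<m+n (d + d) 0<t) (≤-trans size (≤-trans (#-universal {n} cover? cover) cover≤))
    where
    Cover = λ y → z ~ y ⊎ (z ≢ y × c z y ≡ col)
    cover? : ∀ y → Dec (Cover y)
    cover? y = (z ~? y) ⊎-dec (¬? (z ≟ y) ×-dec (c z y ≟ col))
    cover : ∀ y → Cover y
    cover y with z ~? y
    ... | yes p = inj₁ p
    ... | no p = inj₂ (≁⇒≢ p , all y p)
    elsewhere : ∃ λ y → ¬ z ~ y
    elsewhere with z ~? x₀
    ... | yes p = y₀ , λ q → x₀≁y₀ (~-trans (~-sym p) q)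
    ... | no p = x₀ , p
    cls≤ : cls z ≤ d
    cls≤ = let y , ¬zy = elsewhere in joined₁ (joined-sym (¬zy , all y ¬zy))
    cover≤ : # cover? ≤ d + d
    cover≤ = ≤-trans (#-⊎ {n} cover? (z ~?_) (λ y → ¬? (z ≟ y) ×-dec (c z y ≟ col)) (λ _ → id)) (+-mono-≤ cls≤ (deg≤d z col))

  another : ∀ z col → ∃ λ y → ¬ z ~ y × c z y ≢ col
  another z col with any? (λ y → ¬? (z ~? y) ×-dec ¬? (c z y ≟ col))
  ... | yes p = p
  ... | no ¬p = ⊥-elim (not-complete z col all)
    where
    all : ∀ y → ¬ z ~ y → c z y ≡ col
    all y ¬zy with c z y ≟ col
    ... | yes e = e
    ... | no ne = contradiction (y , ¬zy , ne) ¬p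

  module TwoColours (r b : Fin k) (cross : ∀ {x y} → ¬ x ~ y → c x y ≡ r ⊎ c x y ≡ b) where

    r≢b : r ≢ b
    r≢b refl = let y , ¬xy , ne = another x₀ r in ne ([ id , id ]′ (cross ¬xy))

    cover : ∀ z y → z ~ y ⊎ Joined r z y ⊎ Joined b z y
    cover z y with z ~? y
    ... | yes p = inj₁ p
    ... | no p = inj₂ ([ inj₁ ∘ (p ,_) , inj₂ ∘ (p ,_) ]′ (cross p))

    joined-≁ : ∀ {z x y} → Joined r z x → Joined b z y → ¬ x ~ y
    joined-≁ (¬zx , e) (_ , e′) xy = r≢b (trans (sym e) (trans (homogeneous xy ¬zx) e′))

    -- Outside its class `z` has at most `d` edges in each of two colours, which leaves at least n -
    -- 2d vertices for the class.
    t≤cls : ∀ z → t ≤ cls z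
    t≤cls z = +-cancelʳ-≤ (d + d) t (cls z) (≤-trans (≤-reflexive (+-comm t (d + d))) (≤-trans size
      (≤-trans (#-universal {n} cover? cover′)
      (≤-trans (#-⊎₃ {n} cover? (z ~?_) (λ y → ¬? (z ≟ y) ×-dec (c z y ≟ r)) (λ y → ¬? (z ≟ y) ×-dec (c z y ≟ b)) (λ _ → id))
        (+-monoʳ-≤ (cls z) (+-mono-≤ (deg≤d z r) (deg≤d z b)))))))
      where
      Cover = λ y → z ~ y ⊎ (z ≢ y × c z y ≡ r) ⊎ (z ≢ y × c z y ≡ b)
      cover? : ∀ y → Dec (Cover y)
      cover? y = (z ~? y) ⊎-dec ((¬? (z ≟ y) ×-dec (c z y ≟ r)) ⊎-dec (¬? (z ≟ y) ×-dec (c z y ≟ b)))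
      cover′ : ∀ y → Cover y
      cover′ y with cover z y
      ... | inj₁ p = inj₁ p
      ... | inj₂ (inj₁ (p , e)) = inj₂ (inj₁ (≁⇒≢ p , e))
      ... | inj₂ (inj₂ (p , e)) = inj₂ (inj₂ (≁⇒≢ p , e))

    at-most-two : ∀ {col z y y′ y″} → Joined col z y → Joined col z y′ → Joined col z y″ →
      ¬ y ~ y′ → ¬ y ~ y″ → ¬ y′ ~ y″ → ⊥
    at-most-two {_} {_} {y} {y′} {y″} j j′ j″ n₁ n₂ n₃ = <⇒≱ d<3t
      (≤-trans (+-mono-≤ (t≤cls y) (+-mono-≤ (t≤cls y′) (t≤cls y″))) (joined₃ j j′ j″ n₁ n₂ n₃))

    -- If `y` were red to `x`, then `x` would see the classes of `z`, `x′` and `y` in red; likewise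
    -- for `x′`. Hence `y` is blue to all of `z`, `x` and `x′`, which are again three classes in one
    -- colour.
    triangle-free : ∀ {z x x′ y} → Joined r z x → Joined r z x′ → Joined r x x′ → Joined b z y → ⊥
    triangle-free {z} {x} {x′} {y} zx zx′ xx′ zy = at-most-two (joined-sym zy) (blue zx zx′ xx′) (blue zx′ zx (joined-sym xx′))
      (proj₁ zx) (proj₁ zx′) (proj₁ xx′)
      where
      blue : ∀ {u v} → Joined r z u → Joined r z v → Joined r u v → Joined b y u
      blue {u} zu zv uv = joined-sym (¬uy , other (cross ¬uy) λ e →
        at-most-two (joined-sym zu) uv (¬uy , e) (proj₁ zv) (proj₁ zy) (joined-≁ zv zy))
        where
        ¬uy : ¬ u ~ y
        ¬uy = joined-≁ zu zy

    neighbours-joined : ∀ {z x x′ y} → Joined r z x → Joined r z x′ → ¬ x ~ x′ → Joined b z y → Joined b x x′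
    neighbours-joined zx zx′ ¬xx′ zy = ¬xx′ , other (cross ¬xx′) λ e → triangle-free zx zx′ (¬xx′ , e) zy

    -- Suppose the class of `x` is the only red one at `z`. The rest is blue to `z`, so the classes
    -- of `z` and `x` together exceed `d`, and no vertex can be blue to both. Then `x` is red to
    -- everything outside its class, contrary to `another`.
    two : ∀ z → ∃ λ x → ∃ λ y → Joined r z x × Joined r z y × ¬ x ~ y
    two z with another z b
    ... | x , ¬zx , ne with any? (λ y → (¬? (z ~? y) ×-dec (c z y ≟ r)) ×-dec ¬? (x ~? y))
    ...   | yes (y , j , ¬xy) = x , y , (¬zx , other (swap (cross ¬zx)) ne) , j , ¬xy
    ...   | no ¬p = ⊥-elim (last (another x r))
      where
      jzx : Joined r z x
      jzx = ¬zx , other (swap (cross ¬zx)) ne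
      only : ∀ {y} → Joined r z y → x ~ y
      only {y} j with x ~? y
      ... | yes p = p
      ... | no ¬xy = contradiction (y , j , ¬xy) ¬p
      Cover = λ y → z ~ y ⊎ x ~ y ⊎ (z ≢ y × c z y ≡ b)
      cover? : ∀ y → Dec (Cover y)
      cover? y = (z ~? y) ⊎-dec ((x ~? y) ⊎-dec (¬? (z ≟ y) ×-dec (c z y ≟ b)))
      cover′ : ∀ y → Cover y
      cover′ y with cover z y
      ... | inj₁ p = inj₁ p
      ... | inj₂ (inj₁ j) = inj₂ (inj₁ (only j))
      ... | inj₂ (inj₂ (p , e)) = inj₂ (inj₂ (≁⇒≢ p , e))
      large : d < cls z + cls x
      large = +-cancelʳ-≤ d (suc d) (cls z + cls x)
        (≤-trans (≤-trans (≤-reflexive (+-comm 1 (d + d))) (≤-trans (+-monoʳ-≤ (d + d) 0<t) (≤-trans size (#-universal {n} cover? cover′))))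
        (≤-trans (#-⊎₃ {n} cover? (z ~?_) (x ~?_) (λ y → ¬? (z ≟ y) ×-dec (c z y ≟ b)) (λ _ → id))
        (≤-trans (+-monoʳ-≤ (cls z) (+-monoʳ-≤ (cls x) (deg≤d z b))) (≤-reflexive (sym (+-assoc (cls z) (cls x) d))))))
      red : ∀ {y} → Joined b z y → c x y ≡ r
      red {y} j with cross (joined-≁ jzx j)
      ... | inj₁ e = e
      ... | inj₂ e = contradiction (joined₂ (joined-sym j) (joined-sym (joined-≁ jzx j , e)) ¬zx) (<⇒≱ large)
      last : (∃ λ y → ¬ x ~ y × c x y ≢ r) → ⊥
      last (y , ¬xy , ne′) with cover z y
      ... | inj₁ zy = ne′ (trans (sym (homogeneous zy (¬zx ∘ ~-sym))) (trans (sym-c x z) (proj₂ jzx)))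
      ... | inj₂ (inj₁ j) = ¬xy (only j)
      ... | inj₂ (inj₂ j) = ne′ (red j)

  module FiveClasses (r b : Fin k) (cross : ∀ {x y} → ¬ x ~ y → c x y ≡ r ⊎ c x y ≡ b) where

    open TwoColours r b cross
    module Swapped = TwoColours b r (swap ∘ cross)

    -- Once `x` and `y` are joined in red, every other colour follows, since no vertex sees three
    -- classes in one colour. For the same reason there is no sixth class.
    build : ∀ z x x′ y y′ → Joined r z x → Joined r z x′ → ¬ x ~ x′ →
      Joined b z y → Joined b z y′ → ¬ y ~ y′ → c x y ≡ r → Pentagon c
    build z x x′ y y′ zx zx′ ¬xx′ zy zy′ ¬yy′ xyr = record
      { r = r ; b = b ; r≢b = r≢b ; part = part ; rep = rep ; part-rep = part-rep ; colour = colour }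
      where
      red : ∀ {u v} → ¬ u ~ v → ¬ Joined b u v → Joined r u v
      red ¬uv ¬b = ¬uv , other (swap (cross ¬uv)) λ e → ¬b (¬uv , e)
      blue : ∀ {u v} → ¬ u ~ v → ¬ Joined r u v → Joined b u v
      blue ¬uv ¬r = ¬uv , other (cross ¬uv) λ e → ¬r (¬uv , e)
      ¬xy = joined-≁ zx zy
      ¬xy′ = joined-≁ zx zy′
      ¬x′y = joined-≁ zx′ zy
      ¬x′y′ = joined-≁ zx′ zy′
      xy : Joined r x y
      xy = ¬xy , xyr
      yy′ : Joined r y y′
      yy′ = Swapped.neighbours-joined zy zy′ ¬yy′ zx
      xx′ : Joined b x x′
      xx′ = neighbours-joined zx zx′ ¬xx′ zy
      xy′ : Joined b x y′
      xy′ = blue ¬xy′ λ e → at-most-two (joined-sym zx) xy e (proj₁ zy) (proj₁ zy′) ¬yy′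
      x′y : Joined b y x′
      x′y = blue (¬x′y ∘ ~-sym) λ e → at-most-two (joined-sym xy) yy′ e ¬xy′ ¬xx′ (¬x′y′ ∘ ~-sym)
      x′y′ : Joined r y′ x′
      x′y′ = red (¬x′y′ ∘ ~-sym) λ e → at-most-two (joined-sym zy′) (joined-sym xy′) e (proj₁ zx) (proj₁ zx′) ¬xx′
      rep : Fin 5 → Fin n
      -- The order runs along the red pentagon z, x, y, y′, x′.
      rep 0F = z
      rep 1F = x
      rep 2F = y
      rep 3F = y′
      rep 4F = x′
      Link : Fin 5 → Fin 5 → Set
      Link i j = Joined (pent r b i j) (rep i) (rep j)
      link : ∀ i j → i ≢ j → Link i j
      link 0F 0F ne = contradiction refl ne
      link 0F 1F _ = zx
      link 0F 2F _ = zy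
      link 0F 3F _ = zy′
      link 0F 4F _ = zx′
      link 1F 0F _ = joined-sym zx
      link 1F 1F ne = contradiction refl ne
      link 1F 2F _ = xy
      link 1F 3F _ = xy′
      link 1F 4F _ = xx′
      link 2F 0F _ = joined-sym zy
      link 2F 1F _ = joined-sym xy
      link 2F 2F ne = contradiction refl ne
      link 2F 3F _ = yy′
      link 2F 4F _ = x′y
      link 3F 0F _ = joined-sym zy′
      link 3F 1F _ = joined-sym xy′
      link 3F 2F _ = joined-sym yy′
      link 3F 3F ne = contradiction refl ne
      link 3F 4F _ = x′y′
      link 4F 0F _ = joined-sym zx′
      link 4F 1F _ = joined-sym xx′
      link 4F 2F _ = joined-sym x′y
      link 4F 3F _ = joined-sym x′y′
      link 4F 4F ne = contradiction refl ne
      classify : ∀ u → ∃ λ i → rep i ~ u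
      classify u with cover z u
      ... | inj₁ p = 0F , p
      ... | inj₂ (inj₁ j) with x ~? u | x′ ~? u
      ...   | yes p | _ = 1F , p
      ...   | no _ | yes p = 4F , p
      ...   | no p | no q = ⊥-elim (at-most-two zx zx′ j ¬xx′ p q)
      classify u | inj₂ (inj₂ j) with y ~? u | y′ ~? u
      ...   | yes p | _ = 2F , p
      ...   | no _ | yes p = 3F , p
      ...   | no p | no q = ⊥-elim (at-most-two zy zy′ j ¬yy′ p q)
      part : Fin n → Fin 5
      part = proj₁ ∘ classify
      part-rep : ∀ i → part (rep i) ≡ i
      part-rep i with part (rep i) ≟ i
      ... | yes e = e
      ... | no ne = contradiction (proj₂ (classify (rep i))) (proj₁ (link _ _ ne))
      colour : ∀ u v → part u ≢ part v → c u v ≡ pent r b (part u) (part v)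
      colour u v ne with link _ _ ne
      ... | ¬ij , e = trans (homogeneous (~-sym jv) (λ uv → ¬ij (~-trans iu (~-trans uv (~-sym jv)))))
        (trans (sym-c u (rep (part v))) (trans (homogeneous (~-sym iu) (λ ju → ¬ij (~-trans iu (~-sym ju))))
        (trans (sym-c (rep (part v)) (rep (part u))) e)))
        where
        iu = proj₂ (classify u)
        jv = proj₂ (classify v)

    -- Since `x` is already blue to `x′`, it cannot be blue to both `y` and `y′`; exchanging these
    -- two if necessary gives the red edge that `build` asks for.
    pentagon : Pentagon c
    pentagon with two x₀ | Swapped.two x₀
    ... | x , x′ , zx , zx′ , ¬xx′ | y , y′ , zy , zy′ , ¬yy′ with cross (joined-≁ zx zy)
    ...   | inj₁ e = build x₀ x x′ y y′ zx zx′ ¬xx′ zy zy′ ¬yy′ e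
    ...   | inj₂ e with cross (joined-≁ zx zy′)
    ...     | inj₁ e′ = build x₀ x x′ y′ y zx zx′ ¬xx′ zy′ zy (¬yy′ ∘ ~-sym) e′
    ...     | inj₂ e′ = ⊥-elim (at-most-two (joined-≁ zx zy , e) (joined-≁ zx zy′ , e′)
                         (neighbours-joined zx zx′ ¬xx′ zy) ¬yy′ (joined-≁ zx′ zy ∘ ~-sym) (joined-≁ zx′ zy′ ∘ ~-sym))

-- Passing to decidable classes under double negation.

¬¬-∀ : {P : Fin n → Set} → (∀ i → ¬ ¬ P i) → ¬ ¬ (∀ i → P i)
¬¬-∀ {zero} _ k = k λ ()
¬¬-∀ {suc n} p k = p zero λ p₀ → ¬¬-∀ (p ∘ suc) λ ps → k λ { zero → p₀ ; (suc i) → ps i }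

-- Connection by walks is not decided here. As vertices range over a finite set, all instances of
-- excluded middle can be assumed at once when the goal is a negation. The bound `2 ≤ d` forces at
-- least two vertices, as Gallai's theorem needs.
¬¬-pentagon : (c : Colouring k n) → Symmetric c → Gallai c → ∀ d t → 2 ≤ d → d + d + t ≤ n → d < t + (t + t) →
  (∀ x col → deg c x col ≤ d) → ¬ ¬ Pentagon c
¬¬-pentagon {n = zero} c sym-c gallai d t 2≤d size d<3t deg≤d ¬p = <⇒≱ 2≤d (≤-trans (m≤m+n d d) (≤-trans (m≤m+n (d + d) t) (≤-trans size z≤n)))
¬¬-pentagon {n = suc zero} c sym-c gallai d t 2≤d size d<3t deg≤d ¬p = <⇒≱ 2≤d (≤-trans (m≤m+n d d) (≤-trans (m≤m+n (d + d) t) size))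
¬¬-pentagon {n = suc (suc n)} c sym-c gallai d t 2≤d size d<3t deg≤d ¬p =
  disconnected n c sym-c gallai λ r b x y ¬xy →
  ¬¬-∀ (λ u → ¬¬-∀ λ v → ¬¬-excluded-middle) λ _~?_ →
  ¬p (Classes.FiveClasses.pentagon c sym-c d t size d<3t deg≤d (Conn c r b) _~?_ ε (conn-sym c sym-c gallai r b) _◅◅_
    (conn-homogeneous c sym-c gallai r b) ¬xy r b (conn-cross c sym-c gallai r b))

-- Pigeonhole, and finite checks on the 5-cycle and its rotations.

#≤n : {P : Fin n → Set} (P? : Decidable P) → # P? ≤ n
#≤n P? = let f , f-injective , _ = #-enumerate P? in injective⇒≤ f-injective

#-escape : {P Q : Fin n → Set} (P? : Decidable P) (Q? : Decidable Q) → # Q? < # P? → ∃ λ i → P i × ¬ Q i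
#-escape {n} P? Q? Q<P with any? (λ i → P? i ×-dec ¬? (Q? i))
... | yes p = p
... | no ¬p = contradiction (#-mono {n} P? Q? P⇒Q) (<⇒≱ Q<P)
  where
  P⇒Q : ∀ i → _ → _
  P⇒Q i p with Q? i
  ... | yes q = q
  ... | no ¬q = contradiction (i , p , ¬q) ¬p

abstract

  -- Two adjacent vertices of a 5-cycle have a common non-neighbour, two non-adjacent ones a common
  -- neighbour.
  common-neighbour : ∀ i j → i ≢ j → ∃ λ l → l ≢ i × l ≢ j × cyclic l i ≡ cyclic l j
  common-neighbour = from-yes (all? λ i → all? λ j → ¬? (i ≟ j) →-dec
    any? λ l → ¬? (l ≟ i) ×-dec (¬? (l ≟ j) ×-dec (cyclic l i ≟ᵇ cyclic l j)))

  neighbours : ∀ l t → ∃ λ i → ∃ λ j → i ≢ j × l ≢ i × l ≢ j × cyclic l i ≡ t × cyclic l j ≡ t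
  neighbours l true = from-yes (all? λ l → any? λ i → any? λ j → ¬? (i ≟ j) ×-dec
    (¬? (l ≟ i) ×-dec (¬? (l ≟ j) ×-dec ((cyclic l i ≟ᵇ true) ×-dec (cyclic l j ≟ᵇ true))))) l
  neighbours l false = from-yes (all? λ l → any? λ i → any? λ j → ¬? (i ≟ j) ×-dec
    (¬? (l ≟ i) ×-dec (¬? (l ≟ j) ×-dec ((cyclic l i ≟ᵇ false) ×-dec (cyclic l j ≟ᵇ false))))) l

-- Addition modulo 5, tabulated so that the identities below are checked by evaluation. Translations
-- are the rotations of the pentagon.
_⊕_ : Fin 5 → Fin 5 → Fin 5
i ⊕ j = lookup (lookup table i) j
  where
  table : Vec (Vec (Fin 5) 5) 5
  table = (0F ∷ 1F ∷ 2F ∷ 3F ∷ 4F ∷ [])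
        ∷ (1F ∷ 2F ∷ 3F ∷ 4F ∷ 0F ∷ [])
        ∷ (2F ∷ 3F ∷ 4F ∷ 0F ∷ 1F ∷ [])
        ∷ (3F ∷ 4F ∷ 0F ∷ 1F ∷ 2F ∷ [])
        ∷ (4F ∷ 0F ∷ 1F ∷ 2F ∷ 3F ∷ [])
        ∷ []

⊖_ : Fin 5 → Fin 5
⊖ i = lookup (0F ∷ 4F ∷ 3F ∷ 2F ∷ 1F ∷ []) i

abstract

  ⊖-inverse : ∀ i j → (⊖ i) ⊕ (i ⊕ j) ≡ j
  ⊖-inverse = from-yes (all? λ i → all? λ j → ((⊖ i) ⊕ (i ⊕ j)) ≟ j)

  ⊖-self : ∀ i → (⊖ i) ⊕ i ≡ 0F
  ⊖-self = from-yes (all? λ i → ((⊖ i) ⊕ i) ≟ 0F)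

  ⊕-cancel : ∀ i j j′ → i ⊕ j ≡ i ⊕ j′ → j ≡ j′
  ⊕-cancel = from-yes (all? λ i → all? λ j → all? λ j′ → ((i ⊕ j) ≟ (i ⊕ j′)) →-dec (j ≟ j′))

  cyclic-⊕ : ∀ i j j′ → cyclic (i ⊕ j) (i ⊕ j′) ≡ cyclic j j′
  cyclic-⊕ = from-yes (all? λ i → all? λ j → all? λ j′ → cyclic (i ⊕ j) (i ⊕ j′) ≟ᵇ cyclic j j′)

-- Moves part `i` to position `0F`, so that arguments about a distinguished part need treat only
-- that position.
rotate : {c : Colouring k n} → Fin 5 → Pentagon c → Pentagon c
rotate i p = record
  { r = r ; b = b ; r≢b = r≢b
  ; part = λ x → (⊖ i) ⊕ part x
  ; rep = λ j → rep (i ⊕ j)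
  ; part-rep = λ j → trans (cong ((⊖ i) ⊕_) (part-rep (i ⊕ j))) (⊖-inverse i j)
  ; colour = λ x y ne → trans (colour x y (ne ∘ cong ((⊖ i) ⊕_)))
      (cong (if_then r else b) (sym (cyclic-⊕ (⊖ i) (part x) (part y))))
  }
  where open Pentagon p

-- Sizes of the five parts.

module Sizes {c : Colouring k n} (p : Pentagon c) where

  open Pentagon p public

  shade : Bool → Fin k
  shade t = if t then r else b

  part? : ∀ i x → Dec (part x ≡ i)
  part? i x = part x ≟ i

  size : Fin 5 → ℕ
  size i = # (part? i)

  colour-at : ∀ {x y i j t} → part x ≡ i → part y ≡ j → i ≢ j → cyclic i j ≡ t → c x y ≡ shade t
  colour-at {x} {y} refl refl ne e = trans (colour x y ne) (cong shade e)

  module _ {x l i j t} (xl : part x ≡ l) (i≢j : i ≢ j) (l≢i : l ≢ i) (l≢j : l ≢ j)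
    (eᵢ : cyclic l i ≡ t) (eⱼ : cyclic l j ≡ t) where

    private
      two? : ∀ u → Dec (part u ≡ i ⊎ part u ≡ j)
      two? u = part? i u ⊎-dec part? j u

      neighbour? : ∀ u → Dec (x ≢ u × c x u ≡ shade t)
      neighbour? u = ¬? (x ≟ u) ×-dec (c x u ≟ shade t)

      two⇒neighbour : ∀ u → part u ≡ i ⊎ part u ≡ j → x ≢ u × c x u ≡ shade t
      two⇒neighbour u (inj₁ q) = (λ { refl → l≢i (trans (sym xl) q) }) , colour-at xl q l≢i eᵢ
      two⇒neighbour u (inj₂ q) = (λ { refl → l≢j (trans (sym xl) q) }) , colour-at xl q l≢j eⱼ

      size≤two : size i + size j ≤ # two?
      size≤two = #-disjoint {n} two? (part? i) (part? j) (λ _ → inj₁) (λ _ → inj₂) (λ _ q q′ → i≢j (trans (sym q) q′))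

    sizes≤deg : size i + size j ≤ deg c x (shade t)
    sizes≤deg = ≤-trans size≤two (#-mono {n} two? neighbour? two⇒neighbour)

    -- The neighbour `y` lies in the part of `x` itself, hence is counted in addition to the parts
    -- `i` and `j`.
    sizes<deg : ∀ {y} → part y ≡ l → x ≢ y → c x y ≡ shade t → size i + size j < deg c x (shade t)
    sizes<deg {y} yl x≢y e = ≤-trans
      (+-mono-≤ (#-inhabited {n} (_≟ y) y refl) size≤two)
      (#-disjoint {n} neighbour? (_≟ y) two? (λ { _ refl → x≢y , e }) two⇒neighbour
        (λ { _ refl (inj₁ q) → l≢i (trans (sym yl) q) ; _ refl (inj₂ q) → l≢j (trans (sym yl) q) }))

  total : n ≤ size 0F + (size 1F + (size 2F + (size 3F + size 4F)))
  total = ≤-trans (#-universal {n} (λ x → any? λ i → part x ≟ i) λ x → part x , refl)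
    (≤-trans (step 0F (λ x → any? λ i → part x ≟ suc i) (λ { x (zero , e) → inj₁ e ; x (suc i , e) → inj₂ (i , e) }))
    (+-monoʳ-≤ (size 0F)
    (≤-trans (step 1F (λ x → any? λ i → part x ≟ suc (suc i)) (λ { x (zero , e) → inj₁ e ; x (suc i , e) → inj₂ (i , e) }))
    (+-monoʳ-≤ (size 1F)
    (≤-trans (step 2F (λ x → any? λ i → part x ≟ suc (suc (suc i))) (λ { x (zero , e) → inj₁ e ; x (suc i , e) → inj₂ (i , e) }))
    (+-monoʳ-≤ (size 2F)
    (step 3F (part? 4F) (λ { x (zero , e) → inj₁ e ; x (suc zero , e) → inj₂ e }))))))))
    where
    step : ∀ i {P Q : Fin n → Set} {P? : Decidable P} (Q? : Decidable Q) → (∀ x → P x → part x ≡ i ⊎ Q x) → # P? ≤ size i + # Q?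
    step i {P? = P?} Q? f = #-⊎ {n} P? (part? i) Q? f

  pair : ∀ {d} → (∀ x col → deg c x col ≤ d) → ∀ {i j} → i ≢ j → size i + size j ≤ d
  pair deg≤d {i} {j} i≢j with common-neighbour i j i≢j
  ... | l , l≢i , l≢j , e = ≤-trans (sizes≤deg (part-rep l) i≢j l≢i l≢j e refl) (deg≤d _ _)

size-rotate : {c : Colouring k n} (p : Pentagon c) → ∀ i → Sizes.size p i ≤ Sizes.size (rotate i p) 0F
size-rotate {n = n} p i = #-mono {n} (Sizes.part? p i) (Sizes.part? (rotate i p) 0F) (λ { x refl → ⊖-self i })

size-rotate′ : {c : Colouring k n} (p : Pentagon c) → ∀ i → Sizes.size (rotate i p) 0F ≤ Sizes.size p i
size-rotate′ {n = n} p i = #-mono {n} (Sizes.part? (rotate i p) 0F) (Sizes.part? p i)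
  (λ x e → ⊕-cancel (⊖ i) _ _ (trans e (sym (⊖-self i))))

-- Upper bounds: the extra vertex cannot have too many edges.

-- The vertex v added to a coloured complete graph: A is its neighbourhood, w the colours of its edges.
module NewVertex (c : Colouring k n) (sym-c : Symmetric c) {d : ℕ} (deg≤d : ∀ x col → deg c x col ≤ d)
  {A : Fin n → Set} (A? : Decidable A) (w : Fin n → Fin k)
  (triangle : ∀ {x y} → A x → A y → w x ≢ w y → c x y ≡ w x ⊎ c x y ≡ w y)
  (deg-v≤d : ∀ col → # (λ x → A? x ×-dec (w x ≟ col)) ≤ d)
  (deg<d : ∀ {x} → A x → deg c x (w x) < d) where

  module Odd (e : ℕ) (0<e : 0 < e) (n≡ : n ≡ 5 * e) (d≡ : d ≡ e + e) (A≥ : suc (e + e) ≤ # A?) (p : Pentagon c) where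

    open Sizes p

    -- The other four parts form two pairs of at most 2e vertices each, out of 5e.
    size₀≥ : (q : Pentagon c) → e ≤ Sizes.size q 0F
    size₀≥ q = +-cancelʳ-≤ ((e + e) + (e + e)) e (Q.size 0F)
      (≤-trans (≤-reflexive (trans (five e) (sym n≡))) (≤-trans Q.total
      (≤-trans (≤-reflexive (cong (Q.size 0F +_) (sym (+-assoc (Q.size 1F) (Q.size 2F) _))))
      (+-monoʳ-≤ (Q.size 0F) (+-mono-≤ (pair≤ λ ()) (pair≤ λ ()))))))
      where
      module Q = Sizes q
      pair≤ : ∀ {i j} → i ≢ j → Q.size i + Q.size j ≤ e + e
      pair≤ ne = subst (_ ≤_) d≡ (Q.pair deg≤d ne)
      five : ∀ e → e + ((e + e) + (e + e)) ≡ 5 * e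
      five = solve-∀

    size≥ : ∀ i → e ≤ size i
    size≥ i = ≤-trans (size₀≥ (rotate i p)) (size-rotate′ p i)

    size≤ : ∀ i → size i ≤ e
    size≤ i with neighbours i true
    ... | j , _ , _ , i≢j , _ = +-cancelʳ-≤ e (size i) e (≤-trans (+-monoʳ-≤ (size i) (size≥ j)) (subst (_ ≤_) d≡ (pair deg≤d i≢j)))

    -- In each of the two pentagon colours a vertex sees two whole parts, of at least e vertices
    -- each, and 2e = d.
    saturated : ∀ x t → d ≤ deg c x (shade t)
    saturated x t with neighbours (part x) t
    ... | i , j , i≢j , l≢i , l≢j , eᵢ , eⱼ = ≤-trans (≤-trans (≤-reflexive d≡) (+-mono-≤ (size≥ i) (size≥ j)))
      (sizes≤deg {x} refl i≢j l≢i l≢j eᵢ eⱼ)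

    w-shade : ∀ {x} t → A x → w x ≢ shade t
    w-shade {x} t a e = <⇒≱ (deg<d a) (subst (λ z → d ≤ deg c x z) (sym e) (saturated x t))

    -- Otherwise the edge between `x` and `y` would share its colour with an edge at v, but it has a
    -- pentagon colour and these are exhausted.
    agree : ∀ {x y} → A x → A y → part x ≢ part y → w x ≡ w y
    agree {x} {y} ax ay ne with w x ≟ w y
    ... | yes e = e
    ... | no w≢ with triangle ax ay w≢
    ...   | inj₁ e = contradiction (trans (sym e) (colour x y ne)) (w-shade (cyclic (part x) (part y)) ax)
    ...   | inj₂ e = contradiction (trans (sym e) (colour x y ne)) (w-shade (cyclic (part x) (part y)) ay)

    impossible : ⊥
    -- More than d neighbours of v force a `y` with another colour than `x`, necessarily in the same
    -- part. That part has at most e vertices, so some neighbour `z` lies outside it and must agree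
    -- with both.
    impossible with #-∃ {n} A? (≤-trans (s≤s z≤n) A≥)
    ... | x , ax with #-escape {n} A? (λ u → A? u ×-dec (w u ≟ w x)) (≤-trans (s≤s (≤-trans (deg-v≤d (w x)) (≤-reflexive d≡))) A≥)
                    | #-escape {n} A? (part? (part x)) (≤-trans (s≤s (≤-trans (size≤ (part x)) (m≤m+n e e))) A≥)
    ...   | y , ay , ne | z , az , z≢x = w≢ (trans (sym (agree az ay z≢y)) (agree az ax z≢x))
      where
      w≢ : w y ≢ w x
      w≢ q = ne (ay , q)
      z≢y : part z ≢ part y
      z≢y q with part y ≟ part x
      ... | yes q′ = z≢x (trans q q′)
      ... | no q′ = w≢ (agree ay ax q′)

  module Even (e : ℕ) (0<e : 0 < e) (n≡ : n ≡ suc (5 * e)) (d≡ : d ≡ suc (e + e))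
    (A≥ : 2 + 4 * e ≤ # A?) where

    module Large (p : Pentagon c) (large : e < Sizes.size p 0F) where

      open Sizes p

      pair≤ : ∀ {i j} → i ≢ j → size i + size j ≤ suc (e + e)
      pair≤ ne = subst (_ ≤_) d≡ (pair deg≤d ne)

      small : ∀ {i} → i ≢ 0F → size i ≤ e
      small {i} ne = +-cancelʳ-≤ (suc e) (size i) e
        (≤-trans (+-monoʳ-≤ (size i) large) (≤-trans (pair≤ ne) (≤-reflexive (sym (+-suc e e)))))

      -- Part 0 and part `j` have at most 2e + 1 vertices together, `l` and `m` at most e each; of
      -- 5e + 1 vertices at least e remain for part `i`.
      low : ∀ i j l m → 0F ≢ j → l ≢ 0F → m ≢ 0F →
        size 0F + (size 1F + (size 2F + (size 3F + size 4F))) ≡ ((size 0F + size j) + (size l + size m)) + size i → e ≤ size i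
      low i j l m j≢0 l≢0 m≢0 eq = +-cancelˡ-≤ (suc (e + e) + (e + e)) e (size i)
        (≤-trans (≤-reflexive (trans (five e) (sym n≡))) (≤-trans total (≤-trans (≤-reflexive eq)
        (+-monoˡ-≤ (size i) (+-mono-≤ (pair≤ j≢0) (+-mono-≤ (small l≢0) (small m≢0)))))))
        where
        five : ∀ e → (suc (e + e) + (e + e)) + e ≡ suc (5 * e)
        five = solve-∀

      size≥ : ∀ i → e ≤ size i
      size≥ 0F = <⇒≤ large
      size≥ 1F = low 1F 2F 3F 4F (λ ()) (λ ()) (λ ()) (e₁ (size 0F) (size 1F) (size 2F) (size 3F) (size 4F))
        where
        e₁ : ∀ s₀ s₁ s₂ s₃ s₄ → s₀ + (s₁ + (s₂ + (s₃ + s₄))) ≡ ((s₀ + s₂) + (s₃ + s₄)) + s₁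
        e₁ = solve-∀
      size≥ 2F = low 2F 1F 3F 4F (λ ()) (λ ()) (λ ()) (e₂ (size 0F) (size 1F) (size 2F) (size 3F) (size 4F))
        where
        e₂ : ∀ s₀ s₁ s₂ s₃ s₄ → s₀ + (s₁ + (s₂ + (s₃ + s₄))) ≡ ((s₀ + s₁) + (s₃ + s₄)) + s₂
        e₂ = solve-∀
      size≥ 3F = low 3F 1F 2F 4F (λ ()) (λ ()) (λ ()) (e₃ (size 0F) (size 1F) (size 2F) (size 3F) (size 4F))
        where
        e₃ : ∀ s₀ s₁ s₂ s₃ s₄ → s₀ + (s₁ + (s₂ + (s₃ + s₄))) ≡ ((s₀ + s₁) + (s₂ + s₄)) + s₃
        e₃ = solve-∀
      size≥ 4F = low 4F 1F 2F 3F (λ ()) (λ ()) (λ ()) (e₄ (size 0F) (size 1F) (size 2F) (size 3F) (size 4F))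
        where
        e₄ : ∀ s₀ s₁ s₂ s₃ s₄ → s₀ + (s₁ + (s₂ + (s₃ + s₄))) ≡ ((s₀ + s₁) + (s₂ + s₃)) + s₄
        e₄ = solve-∀

      size₀≤ : size 0F ≤ suc e
      size₀≤ = +-cancelʳ-≤ e (size 0F) (suc e) (≤-trans (+-monoʳ-≤ (size 0F) (size≥ 1F)) (pair≤ λ ()))

      saturated : ∀ {x l i j t} → part x ≡ l → i ≢ j → l ≢ i → l ≢ j → cyclic l i ≡ t → cyclic l j ≡ t →
        e < size i → A x → w x ≢ shade t
      saturated {x} {_} {i} {j} {t} xl i≢j l≢i l≢j eᵢ eⱼ e<i ax q = <⇒≱ (deg<d ax)
        (≤-trans (≤-reflexive d≡) (≤-trans (+-mono-≤ e<i (size≥ j))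
        (subst (λ z → _ ≤ deg c x z) (sym q) (sizes≤deg xl i≢j l≢i l≢j eᵢ eⱼ))))

      -- At the classes 1 and 4 colour r, at the classes 2 and 3 colour b is exhausted by the other classes.
      full : Fin 5 → Bool
      full 1F = true
      full 4F = true
      full _ = false

      full-avoided : ∀ {x j} → A x → part x ≡ j → j ≢ 0F → w x ≢ shade (full j)
      full-avoided {j = 0F} ax xj ne = contradiction refl ne
      full-avoided {j = 1F} ax xj _ = saturated {j = 2F} xj (λ ()) (λ ()) (λ ()) refl refl large ax
      full-avoided {j = 2F} ax xj _ = saturated {j = 4F} xj (λ ()) (λ ()) (λ ()) refl refl large ax
      full-avoided {j = 3F} ax xj _ = saturated {j = 1F} xj (λ ()) (λ ()) (λ ()) refl refl large ax
      full-avoided {j = 4F} ax xj _ = saturated {j = 3F} xj (λ ()) (λ ()) (λ ()) refl refl large ax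

      -- At least 4e + 2 neighbours of v and e vertices of part `j` cannot be disjoint among 5e + 1
      -- vertices.
      met : ∀ j → ∃ λ x → A x × part x ≡ j
      met j with any? (λ x → A? x ×-dec part? j x)
      ... | yes q = q
      ... | no ¬q = contradiction (≤-trans (+-mono-≤ A≥ (size≥ j))
        (≤-trans (#-disjoint {n} (λ x → A? x ⊎-dec part? j x) A? (part? j) (λ _ → inj₁) (λ _ → inj₂) (λ x a q → ¬q (x , a , q)))
        (≤-trans (#≤n (λ x → A? x ⊎-dec part? j x)) (≤-reflexive n≡)))) (<⇒≱ (≤-reflexive (six e)))
        where
        six : ∀ e → 2 + 5 * e ≡ 2 + 4 * e + e
        six = solve-∀

      module Third {x} (ax : A x) (out : Outside r b (w x)) where

        -- The edge between the two vertices has the colour exhausted at part `j`, so it equals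
        -- neither of their colours towards v unless these two agree.
        spread : ∀ {u v i j} → A u → w u ≡ w x → part u ≡ i → A v → part v ≡ j → i ≢ j → j ≢ 0F →
          cyclic i j ≡ full j → w v ≡ w x
        spread {u} {v} {i} {j} au ux ui av vj i≢j j≢0 e with w u ≟ w v
        ... | yes q = trans (sym q) ux
        ... | no q with triangle au av q
        ...   | inj₁ t = contradiction (trans (sym ux) (trans (sym t) (colour-at ui vj i≢j refl)))
                           (inside-≢ out (shade-inside (cyclic i j)))
          where
          shade-inside : ∀ t → shade t ≡ r ⊎ shade t ≡ b
          shade-inside true = inj₁ refl
          shade-inside false = inj₂ refl
        ...   | inj₂ t = contradiction (trans (sym t) (colour-at ui vj i≢j e)) (full-avoided av vj j≢0)

        Spread : Fin 5 → Set
        Spread j = ∀ {y} → A y → part y ≡ j → w y ≡ w x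

        next : ∀ {i j} → i ≢ j → j ≢ 0F → cyclic i j ≡ full j → Spread i → Spread j
        next {i} i≢j j≢0 q s ay yj = let u , au , ui = met i in spread au (s au ui) ui ay yj i≢j j≢0 q

        -- The four small parts form a cycle 1, 3, 4, 2 along which `spread` applies, so a third
        -- colour at v reaches all of them from any start.
        1⇒3 : Spread 1F → Spread 3F
        1⇒3 = next (λ ()) (λ ()) refl
        3⇒4 : Spread 3F → Spread 4F
        3⇒4 = next (λ ()) (λ ()) refl
        4⇒2 : Spread 4F → Spread 2F
        4⇒2 = next (λ ()) (λ ()) refl
        2⇒1 : Spread 2F → Spread 1F
        2⇒1 = next (λ ()) (λ ()) refl

        spread₁ : ∀ {i} → part x ≡ i → Spread 1F
        spread₁ {0F} xi ay yj = spread ax refl xi ay yj (λ ()) (λ ()) refl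
        spread₁ {1F} xi = 2⇒1 (4⇒2 (3⇒4 λ ay yj → spread ax refl xi ay yj (λ ()) (λ ()) refl))
        spread₁ {2F} xi ay yj = spread ax refl xi ay yj (λ ()) (λ ()) refl
        spread₁ {3F} xi = 2⇒1 (4⇒2 λ ay yj → spread ax refl xi ay yj (λ ()) (λ ()) refl)
        spread₁ {4F} xi = 2⇒1 λ ay yj → spread ax refl xi ay yj (λ ()) (λ ()) refl

        everywhere : ∀ {j y} → A y → part y ≡ j → j ≢ 0F → w y ≡ w x
        everywhere {0F} _ _ ne = contradiction refl ne
        everywhere {1F} ay yj _ = spread₁ refl ay yj
        everywhere {2F} ay yj _ = 4⇒2 (3⇒4 (1⇒3 (spread₁ refl))) ay yj
        everywhere {3F} ay yj _ = 1⇒3 (spread₁ refl) ay yj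
        everywhere {4F} ay yj _ = 3⇒4 (1⇒3 (spread₁ refl)) ay yj

        impossible : ⊥
        -- The neighbours of v would lie in part 0 or on edges of this one colour: at most (e + 1) +
        -- (2e + 1) < 4e + 2.
        impossible with #-escape {n} A? (λ y → part? 0F y ⊎-dec (A? y ×-dec (w y ≟ w x)))
          (≤-trans (s≤s (≤-trans (#-⊎ {n} (λ y → part? 0F y ⊎-dec (A? y ×-dec (w y ≟ w x))) (part? 0F) (λ y → A? y ×-dec (w y ≟ w x)) (λ _ → id))
            (+-mono-≤ size₀≤ (≤-trans (deg-v≤d (w x)) (≤-reflexive d≡)))))
            (≤-trans (≤-reflexive (three e)) (≤-trans (≤-trans (+-monoʳ-≤ (2 + 3 * e) 0<e) (≤-reflexive (four e))) A≥)))
          where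
          three : ∀ e → suc (suc e + suc (e + e)) ≡ 2 + 3 * e + 1
          three = solve-∀
          four : ∀ e → 2 + 3 * e + e ≡ 2 + 4 * e
          four = solve-∀
        ... | y , ay , ¬q = ¬q (inj₂ (ay , everywhere ay refl (¬q ∘ inj₁)))

      two-coloured : ∀ {x} → A x → w x ≡ r ⊎ w x ≡ b
      two-coloured {x} ax with outside? r b (w x)
      ... | inj₁ q = q
      ... | inj₂ q = ⊥-elim (Third.impossible ax q)

      -- Without an edge of colour shade t to class 0, v would have at most e + e + d edges.
      in-class₀ : ∀ i j t → i ≢ 0F → j ≢ 0F →
        (∀ l → l ≢ 0F → l ≢ i → l ≢ j → full l ≡ t) → ∃ λ x → A x × part x ≡ 0F × w x ≡ shade t
      in-class₀ i j t i≢0 j≢0 fulls with #-escape {n} A? (λ x → part? i x ⊎-dec (part? j x ⊎-dec (A? x ×-dec (w x ≟ shade (not t)))))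
          (≤-trans (s≤s (≤-trans (#-⊎₃ {n} _ (part? i) (part? j) (λ x → A? x ×-dec (w x ≟ shade (not t))) (λ _ → id))
            (+-mono-≤ (small i≢0) (+-mono-≤ (small j≢0) (≤-trans (deg-v≤d (shade (not t))) (≤-reflexive d≡))))))
            (≤-trans (≤-reflexive (four e)) A≥))
          where
          four : ∀ e → suc (e + (e + suc (e + e))) ≡ 2 + 4 * e
          four = solve-∀
      ... | x , ax , ¬q = x , ax , x0 , wx
        where
        wx : w x ≡ shade t
        wx = shade-other t (two-coloured ax) (λ z → ¬q (inj₂ (inj₂ (ax , z))))
          where
          shade-other : ∀ t → w x ≡ r ⊎ w x ≡ b → w x ≢ shade (not t) → w x ≡ shade t
          shade-other true z ne = other (swap z) ne
          shade-other false z ne = other z ne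
        x0 : part x ≡ 0F
        x0 with part x ≟ 0F
        ... | yes z = z
        ... | no z = contradiction (trans wx (cong shade (sym (fulls (part x) z (¬q ∘ inj₁) (¬q ∘ inj₂ ∘ inj₁)))))
          (full-avoided ax refl z)

      impossible : ⊥
      impossible with in-class₀ 2F 3F true (λ ()) (λ ()) (λ where
                      0F n _ _ → contradiction refl n
                      1F _ _ _ → refl
                      2F _ n _ → contradiction refl n
                      3F _ _ n → contradiction refl n
                      4F _ _ _ → refl)
                    | in-class₀ 1F 4F false (λ ()) (λ ()) (λ where
                      0F n _ _ → contradiction refl n
                      1F _ n _ → contradiction refl n
                      2F _ _ _ → refl
                      3F _ _ _ → refl
                      4F _ _ n → contradiction refl n)
      -- Two vertices of part 0 are joined to v in `r` and in `b`. If their common edge has colour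
      -- `r`, then `x` has red degree at least 2e + 1 = d before its edge to v is counted; colour
      -- `b` does the same to `y`.
      ... | x , ax , x0 , wx | y , ay , y0 , wy with triangle ax ay (λ q → r≢b (trans (sym wx) (trans q wy)))
      ...   | inj₁ q = <⇒≱ (deg<d ax) (≤-trans (≤-reflexive d≡) (≤-trans (s≤s (+-mono-≤ (size≥ 1F) (size≥ 4F)))
                (subst (λ z → suc (size 1F + size 4F) ≤ deg c x z) (sym wx)
                  (sizes<deg {t = true} x0 (λ ()) (λ ()) (λ ()) refl refl y0 x≢y (trans q wx)))))
        where
        x≢y : x ≢ y
        x≢y refl = r≢b (trans (sym wx) wy)
      ...   | inj₂ q = <⇒≱ (deg<d ay) (≤-trans (≤-reflexive d≡) (≤-trans (s≤s (+-mono-≤ (size≥ 2F) (size≥ 3F)))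
                (subst (λ z → suc (size 2F + size 3F) ≤ deg c y z) (sym wy)
                  (sizes<deg {t = false} y0 (λ ()) (λ ()) (λ ()) refl refl x0 y≢x (trans (sym-c y x) (trans q wy))))))
        where
        y≢x : y ≢ x
        y≢x refl = r≢b (trans (sym wx) wy)

    -- Five parts of at most e vertices cannot hold 5e + 1, so some part is larger, and it is
    -- rotated to position 0.
    impossible : Pentagon c → ⊥
    impossible p with any? (λ i → e <? Sizes.size p i)
    ... | yes (i , e<) = Large.impossible (rotate i p) (≤-trans e< (size-rotate p i))
    ... | no ¬e< = <⇒≱ (≤-reflexive (sym n≡)) (≤-trans total (≤-trans
        (+-mono-≤ (small 0F) (+-mono-≤ (small 1F) (+-mono-≤ (small 2F) (+-mono-≤ (small 3F) (small 4F))))) (≤-reflexive (five e))))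
      where
      open Sizes p
      small : ∀ i → size i ≤ e
      small i = ≮⇒≥ λ lt → ¬e< (i , lt)
      five : ∀ e → e + (e + (e + (e + e))) ≡ 5 * e
      five = solve-∀

-- From degree bounds to unavoidable structures.

module _ {G : Graph n} (G? : ∀ x y → Dec (G x y)) (c : Colouring k n) where

  neighbours? : ∀ x col y → Dec (G x y × c x y ≡ col)
  neighbours? x col y = G? x y ×-dec (c x y ≟ col)

  -- Both structures are searched for by finite enumeration, so a refutation of their joint absence
  -- suffices; this is where double negations may be used.
  unavoidable : ∀ d → (¬ RainbowK3 G c → (∀ x col → # (neighbours? x col) ≤ d) → ⊥) →
    RainbowK3 G c ⊎ MonoStar G c (suc d)
  unavoidable d absurd
    with any? (λ x → any? λ y → any? λ z → G? x y ×-dec (G? y z ×-dec (G? x z ×-dec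
           (¬? (c x y ≟ c y z) ×-dec (¬? (c y z ≟ c x z) ×-dec ¬? (c x y ≟ c x z))))))
       | any? (λ x → any? λ col → d <? # (neighbours? x col))
  ... | yes rainbow | _ = inj₁ rainbow
  ... | no ¬rainbow | no ¬star = ⊥-elim (absurd ¬rainbow λ x col → ≮⇒≥ λ lt → ¬star (x , col , lt))
  ... | no _ | yes (x , col , lt) =
    let f , f-injective , f-neighbour = #-enumerate (neighbours? x col)
    in inj₂ (x , col , (λ i → f (inject≤ i lt)) , (λ eq → inject≤-injective lt lt _ _ (f-injective eq)) , λ i → f-neighbour (inject≤ i lt))

KplusStar? : ∀ n s x y → Dec (KplusStar n s x y)
KplusStar? n s x y = ¬? (x ≟ y) ×-dec (((toℕ x <? n) ×-dec (toℕ y <? n)) ⊎-dec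
  (((x ≟ fromℕ n) ×-dec (toℕ y <? s)) ⊎-dec ((y ≟ fromℕ n) ×-dec (toℕ x <? s))))

module Restrict {n s d : ℕ} (C : Colouring k (suc n)) (sym-C : Symmetric C)
  (¬rainbow : ¬ RainbowK3 (KplusStar n s) C)
  (deg≤ : ∀ x col → # (neighbours? (KplusStar? n s) C x col) ≤ d) where

  v : Fin (suc n)
  v = fromℕ n

  c : Colouring k n
  c x y = C (inject₁ x) (inject₁ y)

  sym-c : Symmetric c
  sym-c x y = sym-C (inject₁ x) (inject₁ y)

  w : Fin n → Fin k
  w x = C v (inject₁ x)

  A? : ∀ (x : Fin n) → Dec (toℕ x < s)
  A? x = toℕ x <? s

  inject₁< : ∀ (x : Fin n) → toℕ (inject₁ x) < n
  inject₁< x = subst (_< n) (sym (toℕ-inject₁ x)) (toℕ<n x)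

  edge : ∀ {x y} → x ≢ y → KplusStar n s (inject₁ x) (inject₁ y)
  edge {x} {y} ne = ne ∘ inject₁-injective , inj₁ (inject₁< x , inject₁< y)

  edge-v : ∀ {x} → toℕ x < s → KplusStar n s v (inject₁ x)
  edge-v {x} a = fromℕ≢inject₁ , inj₂ (inj₁ (refl , subst (_< s) (sym (toℕ-inject₁ x)) a))

  v-edge : ∀ {x} → toℕ x < s → KplusStar n s (inject₁ x) v
  v-edge {x} a = fromℕ≢inject₁ ∘ sym , inj₂ (inj₂ (refl , subst (_< s) (sym (toℕ-inject₁ x)) a))

  gallai : Gallai c
  -- Triples with a repeated vertex satisfy the condition by symmetry or by reflexivity; only
  -- distinct vertices need the absence of rainbow triangles.
  gallai x y z ne with x ≟ y | x ≟ z | y ≟ z | c y z ≟ c x y | c y z ≟ c x z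
  ... | _ | _ | _ | yes e | _ = inj₁ e
  ... | _ | _ | _ | _ | yes e = inj₂ e
  ... | yes refl | _ | _ | _ | no q = contradiction refl q
  ... | _ | yes refl | _ | no q | _ = contradiction (sym-c y x) q
  ... | _ | _ | yes refl | _ | _ = contradiction refl ne
  ... | no xy | no xz | no yz | no p | no q =
    ⊥-elim (¬rainbow (inject₁ x , inject₁ y , inject₁ z , edge xy , edge yz , edge xz , p ∘ sym , q , ne))

  triangle : ∀ {x y} → toℕ x < s → toℕ y < s → w x ≢ w y → c x y ≡ w x ⊎ c x y ≡ w y
  triangle {x} {y} ax ay ne with c x y ≟ w x | c x y ≟ w y
  ... | yes e | _ = inj₁ e
  ... | no _ | yes e = inj₂ e
  ... | no p | no q = ⊥-elim (¬rainbow (v , inject₁ x , inject₁ y , edge-v ax ,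
      edge (λ { refl → ne refl }) , edge-v ay , p ∘ sym , q , ne))

  deg≤d : ∀ x col → deg c x col ≤ d
  deg≤d x col = ≤-trans
    (#-mono {n} (λ y → ¬? (x ≟ y) ×-dec (c x y ≟ col)) (λ y → nbr? (inject₁ y)) λ { y (ne , e) → edge ne , e })
    (≤-trans (m≤m+n _ _) (≤-trans (≤-reflexive (sym (#-last nbr?))) (deg≤ (inject₁ x) col)))
    where
    nbr? = neighbours? (KplusStar? n s) C (inject₁ x) col

  deg-v≤d : ∀ col → # (λ x → A? x ×-dec (w x ≟ col)) ≤ d
  deg-v≤d col = ≤-trans
    (#-mono {n} (λ x → A? x ×-dec (w x ≟ col)) (λ y → nbr? (inject₁ y)) λ { y (a , e) → edge-v a , e })
    (≤-trans (m≤m+n _ _) (≤-trans (≤-reflexive (sym (#-last nbr?))) (deg≤ v col)))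
    where
    nbr? = neighbours? (KplusStar? n s) C v col

  -- The edge from `x` to v has colour `w x` too and takes up one of the d places.
  deg<d : ∀ {x} → toℕ x < s → deg c x (w x) < d
  deg<d {x} a = ≤-trans (≤-reflexive (+-comm 1 (deg c x (w x)))) (≤-trans
    (+-mono-≤
      (#-mono {n} (λ y → ¬? (x ≟ y) ×-dec (c x y ≟ w x)) (λ y → nbr? (inject₁ y)) λ { y (ne , e) → edge ne , e })
      (bit-yes (nbr? v) (v-edge a , sym-C (inject₁ x) v)))
    (≤-trans (≤-reflexive (sym (#-last nbr?))) (deg≤ (inject₁ x) (w x))))
    where
    nbr? = neighbours? (KplusStar? n s) C (inject₁ x) (w x)

arrows-odd : ∀ e → 0 < e → Arrows k (suc (e + e)) (KplusStar (5 * e) (suc (e + e)))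
arrows-odd e 0<e C sym-C = unavoidable (KplusStar? (5 * e) (suc (e + e))) C (e + e) λ ¬rainbow deg≤ →
  let module R = Restrict C sym-C ¬rainbow deg≤ in
  -- Here d = 2e and t = e: 2d + t = 5e and d < 3t.
  ¬¬-pentagon R.c R.sym-c R.gallai (e + e) e (+-mono-≤ 0<e 0<e) (≤-reflexive (five e)) (m<n+m (e + e) 0<e) R.deg≤d
    (NewVertex.Odd.impossible R.c R.sym-c R.deg≤d R.A? R.w R.triangle R.deg-v≤d R.deg<d e 0<e refl refl
      (#-initial (suc (e + e)) s≤))
  where
  five : ∀ e → (e + e) + (e + e) + e ≡ 5 * e
  five = solve-∀
  s≤ : suc (e + e) ≤ 5 * e
  s≤ = ≤-trans (+-monoˡ-≤ (e + e) 0<e) (≤-trans (m≤m+n (e + (e + e)) (e + e)) (≤-reflexive (five′ e)))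
    where
    five′ : ∀ e → e + (e + e) + (e + e) ≡ 5 * e
    five′ = solve-∀

-- Here d = 2e + 1 and t = e - 1, so 2d + t = 5e + 1. The requirement d < 3t amounts to 5 ≤ e, which
-- is where m ≥ 12 enters.
arrows-even : ∀ e → 5 ≤ e → Arrows k (2 + (e + e)) (KplusStar (suc (5 * e)) (2 + 4 * e))
arrows-even (suc e) (s≤s 4≤e) C sym-C = unavoidable (KplusStar? _ _) C (suc (suc e + suc e)) λ ¬rainbow deg≤ →
  let module R = Restrict C sym-C ¬rainbow deg≤ in
  ¬¬-pentagon R.c R.sym-c R.gallai (suc (suc e + suc e)) e (s≤s (s≤s z≤n)) (≤-reflexive (size e)) large R.deg≤d
    (NewVertex.Even.impossible R.c R.sym-c R.deg≤d R.A? R.w R.triangle R.deg-v≤d R.deg<d (suc e) (s≤s z≤n) refl refl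
      (#-initial (2 + 4 * suc e) (≤-trans (m≤m+n _ e) (≤-reflexive (s≡ e)))))
  where
  size : ∀ e → suc (suc e + suc e) + suc (suc e + suc e) + e ≡ suc (5 * suc e)
  size = solve-∀
  s≡ : ∀ e → 2 + 4 * suc e + e ≡ suc (5 * suc e)
  s≡ = solve-∀
  large : suc (suc e + suc e) < e + (e + e)
  large = ≤-trans (≤-reflexive (four e)) (+-monoˡ-≤ (e + e) 4≤e)
    where
    four : ∀ e → suc (suc (suc e + suc e)) ≡ 4 + (e + e)
    four = solve-∀

-- Monotonicity, and reduction of both numbers to two statements.

arrows-embed : ∀ {N₁ N₂ m} {G₁ : Graph N₁} {G₂ : Graph N₂} (ι : Fin N₁ → Fin N₂) → Injective _≡_ _≡_ ι →
  (∀ {x y} → G₁ x y → G₂ (ι x) (ι y)) → Arrows k m G₁ → Arrows k m G₂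
arrows-embed ι ι-injective hom arrows c sym-c with arrows (λ x y → c (ι x) (ι y)) (λ x y → sym-c (ι x) (ι y))
... | inj₁ (x , y , z , xy , yz , xz , colours) = inj₁ (ι x , ι y , ι z , hom xy , hom yz , hom xz , colours)
... | inj₂ (x , col , f , f-injective , star) =
  inj₂ (ι x , col , ι ∘ f , f-injective ∘ ι-injective , λ i → hom (proj₁ (star i)) , proj₂ (star i))

KplusStar-mono : ∀ {n s s′ x y} → s ≤ s′ → KplusStar n s x y → KplusStar n s′ x y
KplusStar-mono s≤s′ (ne , inj₁ e) = ne , inj₁ e
KplusStar-mono s≤s′ (ne , inj₂ (inj₁ (e , lt))) = ne , inj₂ (inj₁ (e , ≤-trans lt s≤s′))
KplusStar-mono s≤s′ (ne , inj₂ (inj₂ (e , lt))) = ne , inj₂ (inj₂ (e , ≤-trans lt s≤s′))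

-- The graph with s + 1 extra edges sits inside the complete graph on n + 1 vertices, and every
-- complete graph on at most n vertices sits inside the one with s extra edges. So the two arrow
-- statements settle the ordinary number as well.
gr-and-gr* : ∀ {k m n s} → suc s ≤ n → Arrows k m (KplusStar n (suc s)) → ¬ Arrows k m (KplusStar n s) →
  IsGR k m (suc n) × IsGRStar k m (suc n) (suc s)
gr-and-gr* {k} {m} {n} {s} s<n arrows ¬arrows =
  (arrows-embed id id proj₁ arrows , λ n₁ arrows₁ → ≮⇒≥ λ n₁<n+1 → ¬arrows (from-complete n₁<n+1 arrows₁)) ,
  n , refl , s<n , arrows , λ s₁ _ arrows₁ → ≰⇒> λ s₁≤s → ¬arrows (arrows-embed id id (KplusStar-mono s₁≤s) arrows₁)
  where
  from-complete : ∀ {n₁} → n₁ < suc n → Arrows k m (Complete n₁) → Arrows k m (KplusStar n s)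
  from-complete {n₁} lt = arrows-embed ι ι-injective λ ne → ne ∘ ι-injective , inj₁ (below _ , below _)
    where
    ι : Fin n₁ → Fin (suc n)
    ι x = inject≤ x (<⇒≤ lt)
    ι-injective : Injective _≡_ _≡_ ι
    ι-injective = inject≤-injective (<⇒≤ lt) (<⇒≤ lt) _ _
    below : ∀ x → toℕ (ι x) < n
    below x = subst (_< n) (sym (toℕ-inject≤ x (<⇒≤ lt))) (≤-trans (toℕ<n x) (s≤s⁻¹ lt))

-- Lower bounds: colourings constant on consecutive blocks.

start : ∀ {r} → Vec ℕ r → Fin r → ℕ
start (w ∷ ws) zero = 0
start (w ∷ ws) (suc j) = w + start ws j

-- Positions past the end fall by default into the last block; `locate-end` excludes them by its
-- hypothesis.
locate : ∀ {r} → Vec ℕ (suc r) → ℕ → Fin (suc r)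
locate (w ∷ []) a = zero
locate (w ∷ w′ ∷ ws) a with a <? w
... | yes _ = zero
... | no _ = suc (locate (w′ ∷ ws) (a ∸ w))

start-locate : ∀ {r} (ws : Vec ℕ (suc r)) a → start ws (locate ws a) ≤ a
start-locate (w ∷ []) a = z≤n
start-locate (w ∷ w′ ∷ ws) a with a <? w
... | yes _ = z≤n
... | no a≮w = ≤-trans (+-monoʳ-≤ w (start-locate (w′ ∷ ws) (a ∸ w))) (≤-reflexive (m+[n∸m]≡n (≮⇒≥ a≮w)))

locate-end : ∀ {r} (ws : Vec ℕ (suc r)) a → a < sum ws → a < start ws (locate ws a) + lookup ws (locate ws a)
locate-end (w ∷ []) a a< = subst (a <_) (+-identityʳ w) a<
locate-end (w ∷ w′ ∷ ws) a a< with a <? w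
... | yes a<w = a<w
... | no a≮w = subst₂ _<_ (m+[n∸m]≡n (≮⇒≥ a≮w)) (sym (+-assoc w _ _))
  (+-monoʳ-< w (locate-end (w′ ∷ ws) (a ∸ w) (+-cancelˡ-< w _ _ (subst (_< _) (sym (m+[n∸m]≡n (≮⇒≥ a≮w))) a<))))

#-interval : ∀ {m N lo wd} {f : Fin m → Fin N} → Injective _≡_ _≡_ f → {P : Fin m → Set} (P? : Decidable P) →
  (∀ i → P i → lo ≤ toℕ (f i) × toℕ (f i) < lo + wd) → # P? ≤ wd
#-interval {lo = lo} {wd} {f} f-injective P? bounds with #-enumerate P?
... | g , g-injective , g-P = injective⇒≤ {f = h} h-injective
  where
  lower : ∀ u → lo ≤ toℕ (f (g u))
  lower u = proj₁ (bounds (g u) (g-P u))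
  upper : ∀ u → toℕ (f (g u)) ∸ lo < wd
  upper u = +-cancelˡ-< lo _ _ (subst (_< lo + wd) (sym (m+[n∸m]≡n (lower u))) (proj₂ (bounds (g u) (g-P u))))
  h : Fin (# P?) → Fin wd
  h u = fromℕ< (upper u)
  h-injective : Injective _≡_ _≡_ h
  h-injective {u} {u′} eq = g-injective (f-injective (toℕ-injective
    (∸-cancelʳ-≡ (lower u) (lower u′) (fromℕ<-injective _ _ (upper u) (upper u′) eq))))

-- The condition `M-gallai` includes equal labels, since a triangle may have several vertices in one
-- block.
module Blocks (3≤k : 3 ≤ k) {n s m : ℕ} (0<m : 0 < m) (ws : Vec ℕ 6) (n≡ : suc n ≡ sum ws)
  (M : Fin 6 → Fin 6 → Fin 3) (M-sym : ∀ i j → M i j ≡ M j i)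
  (M-gallai : ∀ i j l → ¬ (M i j ≢ M j l × M j l ≢ M i l × M i j ≢ M i l)) where

  label : Fin (suc n) → Fin 6
  label x = locate ws (toℕ x)

  in-block : ∀ {x j} → label x ≡ j → start ws j ≤ toℕ x × toℕ x < start ws j + lookup ws j
  in-block {x} refl = start-locate ws (toℕ x) , locate-end ws (toℕ x) (subst (toℕ x <_) n≡ (toℕ<n x))

  paint : Fin 3 → Fin k
  paint t = inject≤ t 3≤k

  module _ {f : Fin m → Fin (suc n)} (f-injective : Injective _≡_ _≡_ f) where

    private
      block? : ∀ j i → Dec (label (f i) ≡ j)
      block? j i = label (f i) ≟ j

      block≤ : ∀ j → # (block? j) ≤ lookup ws j
      block≤ j = #-interval f-injective (block? j) (λ _ → in-block)

    two-blocks : ∀ j₁ j₂ → (∀ i → label (f i) ≡ j₁ ⊎ label (f i) ≡ j₂) → m ≤ lookup ws j₁ + lookup ws j₂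
    two-blocks j₁ j₂ cover = ≤-trans (#-universal {m} (λ i → block? j₁ i ⊎-dec block? j₂ i) cover)
      (≤-trans (#-⊎ {m} _ (block? j₁) (block? j₂) (λ _ → id)) (+-mono-≤ (block≤ j₁) (block≤ j₂)))

    three-blocks : ∀ j₁ j₂ j₃ → (∀ i → label (f i) ≡ j₁ ⊎ label (f i) ≡ j₂ ⊎ label (f i) ≡ j₃) →
      m ≤ lookup ws j₁ + (lookup ws j₂ + lookup ws j₃)
    three-blocks j₁ j₂ j₃ cover = ≤-trans (#-universal {m} (λ i → block? j₁ i ⊎-dec (block? j₂ i ⊎-dec block? j₃ i)) cover)
      (≤-trans (#-⊎₃ {m} _ (block? j₁) (block? j₂) (block? j₃) (λ _ → id)) (+-mono-≤ (block≤ j₁) (+-mono-≤ (block≤ j₂) (block≤ j₃))))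

  no-arrows : (∀ x t (f : Fin m → Fin (suc n)) → Injective _≡_ _≡_ f →
    ¬ (∀ i → KplusStar n s x (f i) × M (label x) (label (f i)) ≡ t)) → ¬ Arrows k m (KplusStar n s)
  no-arrows no-star arrows with arrows (λ x y → paint (M (label x) (label y))) (λ x y → cong paint (M-sym (label x) (label y)))
  ... | inj₁ (x , y , z , _ , _ , _ , p , q , q′) = M-gallai (label x) (label y) (label z) (p ∘ cong paint , q ∘ cong paint , q′ ∘ cong paint)
  -- The colour `col` is a priori any of the k colours; the first edge of the star, present because
  -- m > 0, identifies it with an entry of the matrix.
  ... | inj₂ (x , col , f , f-injective , star) = no-star x (M (label x) (label (f i₀))) f f-injective
    λ i → proj₁ (star i) , inject≤-injective 3≤k 3≤k _ _ (trans (proj₂ (star i)) (sym (proj₂ (star i₀))))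
    where
    i₀ : Fin m
    i₀ = fromℕ< 0<m

matrix : Vec (Vec (Fin 3) 6) 6 → Fin 6 → Fin 6 → Fin 3
matrix rows i j = lookup (lookup rows i) j

-- The pentagon colouring on blocks 0 to 4, with the third colour inside the blocks and on all edges
-- at v, which is block 5.
matrix-odd : Fin 6 → Fin 6 → Fin 3
matrix-odd = matrix
  ( (2F ∷ 0F ∷ 1F ∷ 1F ∷ 0F ∷ 2F ∷ [])
  ∷ (0F ∷ 2F ∷ 0F ∷ 1F ∷ 1F ∷ 2F ∷ [])
  ∷ (1F ∷ 0F ∷ 2F ∷ 0F ∷ 1F ∷ 2F ∷ [])
  ∷ (1F ∷ 1F ∷ 0F ∷ 2F ∷ 0F ∷ 2F ∷ [])
  ∷ (0F ∷ 1F ∷ 1F ∷ 0F ∷ 2F ∷ 2F ∷ [])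
  ∷ (2F ∷ 2F ∷ 2F ∷ 2F ∷ 2F ∷ 2F ∷ [])
  ∷ [])

-- v, in block 5, copies the vertices of block 2; it is not adjacent to block 4.
matrix-even : Fin 6 → Fin 6 → Fin 3
matrix-even = matrix
  ( (2F ∷ 0F ∷ 1F ∷ 1F ∷ 0F ∷ 1F ∷ [])
  ∷ (0F ∷ 2F ∷ 0F ∷ 1F ∷ 1F ∷ 0F ∷ [])
  ∷ (1F ∷ 0F ∷ 2F ∷ 0F ∷ 1F ∷ 2F ∷ [])
  ∷ (1F ∷ 1F ∷ 0F ∷ 2F ∷ 0F ∷ 0F ∷ [])
  ∷ (0F ∷ 1F ∷ 1F ∷ 0F ∷ 2F ∷ 1F ∷ [])
  ∷ (1F ∷ 0F ∷ 2F ∷ 0F ∷ 1F ∷ 2F ∷ [])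
  ∷ [])

symmetric? : (M : Fin 6 → Fin 6 → Fin 3) → Dec (∀ i j → M i j ≡ M j i)
symmetric? M = all? λ i → all? λ j → M i j ≟ M j i

gallai? : (M : Fin 6 → Fin 6 → Fin 3) → Dec (∀ i j l → ¬ (M i j ≢ M j l × M j l ≢ M i l × M i j ≢ M i l))
gallai? M = all? λ i → all? λ j → all? λ l → ¬? (¬? (M i j ≟ M j l) ×-dec (¬? (M j l ≟ M i l) ×-dec ¬? (M i j ≟ M i l)))

abstract

  odd-symmetric : ∀ i j → matrix-odd i j ≡ matrix-odd j i
  odd-symmetric = from-yes (symmetric? matrix-odd)

  odd-gallai : ∀ i j l → ¬ (matrix-odd i j ≢ matrix-odd j l × matrix-odd j l ≢ matrix-odd i l × matrix-odd i j ≢ matrix-odd i l)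
  odd-gallai = from-yes (gallai? matrix-odd)

  even-symmetric : ∀ i j → matrix-even i j ≡ matrix-even j i
  even-symmetric = from-yes (symmetric? matrix-even)

  even-gallai : ∀ i j l → ¬ (matrix-even i j ≢ matrix-even j l × matrix-even j l ≢ matrix-even i l × matrix-even i j ≢ matrix-even i l)
  even-gallai = from-yes (gallai? matrix-even)

  -- Two blocks contain at most 2e vertices. The exception is v in the third colour, where the
  -- number of its edges gives the bound.
  odd-neighbours : ∀ i t → (i ≡ 5F × t ≡ 2F) ⊎ ∃ λ j₁ → ∃ λ j₂ → ∀ j → matrix-odd i j ≡ t → j ≡ j₁ ⊎ j ≡ j₂
  odd-neighbours = from-yes (all? λ i → all? λ t → ((i ≟ 5F) ×-dec (t ≟ 2F)) ⊎-dec
    any? λ j₁ → any? λ j₂ → all? λ j → (matrix-odd i j ≟ t) →-dec ((j ≟ j₁) ⊎-dec (j ≟ j₂)))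

  -- Block 1 is the large one.
  even-neighbours : ∀ i t →
    (∃ λ j₁ → ∃ λ j₂ → j₁ ≢ j₂ × (∀ j → matrix-even i j ≡ t × ¬ (i ≡ 4F × j ≡ 5F) → j ≡ j₁ ⊎ j ≡ j₂)) ⊎
    (∃ λ j₁ → ∃ λ j₂ → j₁ ≢ 1F × j₂ ≢ 1F × (∀ j → matrix-even i j ≡ t × ¬ (i ≡ 4F × j ≡ 5F) → j ≡ j₁ ⊎ j ≡ j₂ ⊎ j ≡ 5F))
  even-neighbours = from-yes (all? λ i → all? λ t →
    (any? λ j₁ → any? λ j₂ → ¬? (j₁ ≟ j₂) ×-dec (all? λ j →
      ((matrix-even i j ≟ t) ×-dec ¬? ((i ≟ 4F) ×-dec (j ≟ 5F))) →-dec ((j ≟ j₁) ⊎-dec (j ≟ j₂)))) ⊎-dec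
    (any? λ j₁ → any? λ j₂ → ¬? (j₁ ≟ 1F) ×-dec (¬? (j₂ ≟ 1F) ×-dec (all? λ j →
      ((matrix-even i j ≟ t) ×-dec ¬? ((i ≟ 4F) ×-dec (j ≟ 5F))) →-dec ((j ≟ j₁) ⊎-dec ((j ≟ j₂) ⊎-dec (j ≟ 5F)))))))

-- Lower bounds: verification of the two block colourings.

¬arrows-odd : 3 ≤ k → ∀ e → 0 < e → ¬ Arrows k (suc (e + e)) (KplusStar (5 * e) (e + e))
¬arrows-odd 3≤k e 0<e = B.no-arrows no-star
  where
  ws : Vec ℕ 6
  ws = e ∷ e ∷ e ∷ e ∷ e ∷ 1 ∷ []
  n≡ : ∀ e → suc (5 * e) ≡ e + (e + (e + (e + (e + (1 + 0)))))
  n≡ = solve-∀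
  start₅ : ∀ e → e + (e + (e + (e + (e + 0)))) ≡ 5 * e
  start₅ = solve-∀
  module B = Blocks 3≤k {5 * e} {e + e} {suc (e + e)} (s≤s z≤n) ws (n≡ e) matrix-odd odd-symmetric odd-gallai
  width≤ : ∀ j → lookup ws j ≤ e
  width≤ 0F = ≤-refl
  width≤ 1F = ≤-refl
  width≤ 2F = ≤-refl
  width≤ 3F = ≤-refl
  width≤ 4F = ≤-refl
  width≤ 5F = 0<e
  no-star : ∀ x t (f : Fin (suc (e + e)) → Fin (suc (5 * e))) → Injective _≡_ _≡_ f →
    ¬ (∀ i → KplusStar (5 * e) (e + e) x (f i) × matrix-odd (B.label x) (B.label (f i)) ≡ t)
  no-star x t f f-injective star with odd-neighbours (B.label x) t
  ... | inj₂ (j₁ , j₂ , only) = 1+n≰n (≤-trans (B.two-blocks f-injective j₁ j₂ (λ i → only _ (proj₂ (star i))))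
      (+-mono-≤ (width≤ j₁) (width≤ j₂)))
  ... | inj₁ (x₅ , _) = 1+n≰n (injective⇒≤ {f = λ i → fromℕ< (below i)} λ {i} {i′} eq →
      f-injective (toℕ-injective (fromℕ<-injective _ _ (below i) (below i′) eq)))
    where
    x≥ : 5 * e ≤ toℕ x
    x≥ = subst (_≤ toℕ x) (start₅ e) (proj₁ (B.in-block x₅))
    below : ∀ i → toℕ (f i) < e + e
    below i with proj₁ (star i)
    ... | _ , inj₁ (x< , _) = contradiction x≥ (<⇒≱ x<)
    ... | _ , inj₂ (inj₁ (_ , lt)) = lt
    ... | _ , inj₂ (inj₂ (_ , x<)) = contradiction x≥ (<⇒≱ (≤-trans x< (+-monoʳ-≤ e (m≤m+n e _))))

¬arrows-even : 3 ≤ k → ∀ e → 0 < e → ¬ Arrows k (2 + (e + e)) (KplusStar (suc (5 * e)) (1 + 4 * e))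
¬arrows-even 3≤k e 0<e = B.no-arrows no-star
  where
  ws : Vec ℕ 6
  ws = e ∷ suc e ∷ e ∷ e ∷ e ∷ 1 ∷ []
  n≡ : ∀ e → suc (suc (5 * e)) ≡ e + (suc e + (e + (e + (e + (1 + 0)))))
  n≡ = solve-∀
  start₅ : ∀ e → e + (suc e + (e + (e + (e + 0)))) ≡ suc (5 * e)
  start₅ = solve-∀
  start₄ : ∀ e → e + (suc e + (e + (e + 0))) ≡ 1 + 4 * e
  start₄ = solve-∀
  module B = Blocks 3≤k {suc (5 * e)} {1 + 4 * e} {2 + (e + e)} (s≤s z≤n) ws (n≡ e) matrix-even even-symmetric even-gallai
  width≤ : ∀ j → j ≢ 1F → lookup ws j ≤ e
  width≤ 0F _ = ≤-refl
  width≤ 1F ne = contradiction refl ne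
  width≤ 2F _ = ≤-refl
  width≤ 3F _ = ≤-refl
  width≤ 4F _ = ≤-refl
  width≤ 5F _ = 0<e
  width≤′ : ∀ j → lookup ws j ≤ suc e
  width≤′ j with j ≟ 1F
  ... | yes refl = ≤-refl
  ... | no ne = m≤n⇒m≤1+n (width≤ j ne)
  -- Of two distinct blocks at most one is the large block 1.
  widths≤ : ∀ j₁ j₂ → j₁ ≢ j₂ → lookup ws j₁ + lookup ws j₂ ≤ suc (e + e)
  widths≤ j₁ j₂ ne with j₁ ≟ 1F
  ... | no ne₁ = ≤-trans (+-mono-≤ (width≤ j₁ ne₁) (width≤′ j₂)) (≤-reflexive (+-suc e e))
  ... | yes refl = +-mono-≤ (width≤′ j₁) (width≤ j₂ (ne ∘ sym))
  no-star : ∀ x t (f : Fin (2 + (e + e)) → Fin (suc (suc (5 * e)))) → Injective _≡_ _≡_ f →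
    ¬ (∀ i → KplusStar (suc (5 * e)) (1 + 4 * e) x (f i) × matrix-even (B.label x) (B.label (f i)) ≡ t)
  no-star x t f f-injective star = bound (even-neighbours (B.label x) t)
    where
    -- Block 4 starts at position 1 + 4e, which is exactly the number of vertices joined to v.
    nonadjacent : ∀ i → ¬ (B.label x ≡ 4F × B.label (f i) ≡ 5F)
    nonadjacent i (x₄ , y₅) with subst (_≤ toℕ x) (start₄ e) (proj₁ (B.in-block x₄)) | subst (_≤ toℕ (f i)) (start₅ e) (proj₁ (B.in-block y₅)) | proj₁ (star i)
    ... | _ | y≥ | _ , inj₁ (_ , y<) = <⇒≱ y< y≥
    ... | _ | y≥ | _ , inj₂ (inj₁ (_ , y<)) = <⇒≱ y< (≤-trans (s≤s (*-monoˡ-≤ e 4≤5)) y≥)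
      where
      4≤5 : 4 ≤ 5
      4≤5 = n≤1+n 4
    ... | x≥ | _ | _ , inj₂ (inj₂ (_ , x<)) = <⇒≱ x< x≥
    bound : _ → ⊥
    bound (inj₁ (j₁ , j₂ , ne , only)) = 1+n≰n (≤-trans
      (B.two-blocks f-injective j₁ j₂ (λ i → only _ (proj₂ (star i) , nonadjacent i))) (widths≤ j₁ j₂ ne))
    -- A third block is possible only if it is v alone and the other two are small: e + e + 1 < m.
    bound (inj₂ (j₁ , j₂ , ne₁ , ne₂ , only)) = 1+n≰n (≤-trans
      (B.three-blocks f-injective j₁ j₂ 5F (λ i → only _ (proj₂ (star i) , nonadjacent i)))
      (≤-trans (+-mono-≤ (width≤ j₁ ne₁) (+-monoˡ-≤ 1 (width≤ j₂ ne₂))) (≤-reflexive (eq e))))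
      where
      eq : ∀ e → e + (e + 1) ≡ suc (e + e)
      eq = solve-∀

theorem4p6 : (k : ℕ) → 3 ≤ k →
    ((m : ℕ) → 12 ≤ m → m % 2 ≡ 0 →
    Σ ℕ λ n → IsGR k m n × IsGRStar k m n (2 * m ∸ 2))
    × ((m : ℕ) → 3 ≤ m → m % 2 ≡ 1 →
    Σ ℕ λ n → IsGR k m n × IsGRStar k m n m)
theorem4p6 k 3≤k =
  (λ m 12≤m m%2 → even m (m / 2) (trans (m≡m%n+[m/n]*n m 2) (cong (_+ (m / 2) * 2) m%2)) 12≤m) ,
  (λ m 3≤m m%2 → odd m (m / 2) (trans (m≡m%n+[m/n]*n m 2) (cong (_+ (m / 2) * 2) m%2)) 3≤m)
  where
  double : ∀ e → e * 2 ≡ e + e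
  double = solve-∀

  even : ∀ m q → m ≡ q * 2 → 12 ≤ m → Σ ℕ λ n → IsGR k m n × IsGRStar k m n (2 * m ∸ 2)
  even m zero refl ()
  -- For m = 2e + 2 the Gallai-Ramsey number is 5e + 2, and 2m - 2 = 4e + 2.
  even m (suc e) m≡ 12≤m = suc (suc (5 * e)) ,
    subst₂ (λ m s → IsGR k m (suc (suc (5 * e))) × IsGRStar k m (suc (suc (5 * e))) s) (sym m≡′) s≡
      (gr-and-gr* s≤n (arrows-even e 5≤e) (¬arrows-even 3≤k e (≤-trans (s≤s z≤n) 5≤e)))
    where
    m≡′ : m ≡ 2 + (e + e)
    m≡′ = trans m≡ (cong (2 +_) (double e))
    5≤e : 5 ≤ e
    5≤e = s≤s⁻¹ (*-cancelʳ-≤ 6 (suc e) 2 (subst (12 ≤_) m≡ 12≤m))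
    s≡ : 2 + 4 * e ≡ 2 * m ∸ 2
    s≡ = trans (cong (_∸ 2) (four e)) (cong (λ m → 2 * m ∸ 2) (sym m≡′))
      where
      four : ∀ e → 2 + (2 + 4 * e) ≡ 2 * (2 + (e + e))
      four = solve-∀
    s≤n : 2 + 4 * e ≤ suc (5 * e)
    s≤n = s≤s (+-monoˡ-≤ (4 * e) (≤-trans (s≤s z≤n) 5≤e))

  odd : ∀ m q → m ≡ suc (q * 2) → 3 ≤ m → Σ ℕ λ n → IsGR k m n × IsGRStar k m n m
  odd m zero refl (s≤s ())
  odd m e@(suc _) m≡ _ = suc (5 * e) ,
    subst (λ m → IsGR k m (suc (5 * e)) × IsGRStar k m (suc (5 * e)) m) (sym (trans m≡ (cong suc (double e))))
      (gr-and-gr* (≤-trans (+-monoˡ-≤ (e + e) (s≤s z≤n))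
          (≤-trans (m≤m+n (e + (e + e)) (e + e)) (≤-reflexive (five e))))
        (arrows-odd e (s≤s z≤n)) (¬arrows-odd 3≤k e (s≤s z≤n)))
    where
    five : ∀ e → e + (e + e) + (e + e) ≡ 5 * e
    five = solve-∀
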